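{- For every integer $m\ge 2$, $$\pi_f(K_{1,m,m})=\frac{24m}{8m+5+3/(2\lceil m/2\rceil-1)}.$$
   Context: $K_{1,m,m}$ is the complete tripartite graph with parts of sizes $1,m,m$. Two edges are nonincident if they share no endpoint. A linear ordering of $V(G)$ separates a pair of nonincident edges if both endpoints of one edge precede both endpoints of the other. $\pi_t(G)$ is the minimum length of a list of linear orderings of $V(G)$ (repetitions allowed) separating every pair of nonincident edges at least $t$ times, and the fractional separation dimension is $\pi_f(G)=\liminf_{t\to\infty}\pi_t(G)/t$. -}

module Defs where

open import Data.Nat using (ℕ; zero; suc; _+_; _*_; _∸_; _<_; _≤_; _≥_; _<ᵇ_; ⌈_/2⌉)
open import Data.Nat.Properties using (_≟_)
open import Data.Fin using (Fin; toℕ)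
open import Data.Fin.Permutation using (Permutation′; _⟨$⟩ʳ_)
open import Data.Bool using (Bool; true; false; _∧_; _∨_; if_then_else_)
open import Data.List using (List; length; filter; _∷_; [])
open import Data.Product using (Σ; _×_; _,_; ∃-syntax)
open import Data.Integer using (+_)
open import Data.Rational using (ℚ; _/_; _-_; Positive) renaming (_≤_ to _≤ℚ_; _+_ to _+ℚ_)
open import Relation.Nullary using (¬_)
open import Relation.Binary.PropositionalEquality using (_≡_)

-- Vertices of K_{1,m,m}: Fin (1 + m + m).
-- Part 0 = {0}, part 1 = {1..m}, part 2 = {m+1..2m}.
part : (m : ℕ) → Fin (1 + m + m) → ℕ
part m v with toℕ v
... | zero = 0
... | suc k = if k <ᵇ m then 1 else 2

Adj : (m : ℕ) → Fin (1 + m + m) → Fin (1 + m + m) → Set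
Adj m u v = ¬ (part m u ≡ part m v)

-- a linear ordering of V: a permutation giving each vertex its position
LinOrd : ℕ → Set
LinOrd n = Permutation′ n

pos : {n : ℕ} → LinOrd n → Fin n → ℕ
pos σ v = toℕ (σ ⟨$⟩ʳ v)

precedes : {n : ℕ} → LinOrd n → (a b c d : Fin n) → Bool
precedes σ a b c d =
  (pos σ a <ᵇ pos σ c) ∧ (pos σ a <ᵇ pos σ d) ∧ (pos σ b <ᵇ pos σ c) ∧ (pos σ b <ᵇ pos σ d)

separates : {n : ℕ} → LinOrd n → (a b c d : Fin n) → Bool
separates σ a b c d = precedes σ a b c d ∨ precedes σ c d a b

countSep : {n : ℕ} → List (LinOrd n) → (a b c d : Fin n) → ℕ
countSep [] a b c d = 0
countSep (σ ∷ L) a b c d =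
  (if separates σ a b c d then 1 else 0) + countSep L a b c d

NonincidentPair : (m : ℕ) → (a b c d : Fin (1 + m + m)) → Set
NonincidentPair m a b c d =
  Adj m a b × Adj m c d ×
  ¬ (a ≡ c) × ¬ (a ≡ d) × ¬ (b ≡ c) × ¬ (b ≡ d)

TSeparating : (m t : ℕ) → List (LinOrd (1 + m + m)) → Set
TSeparating m t L = ∀ a b c d → NonincidentPair m a b c d → t ≤ countSep L a b c d

IsPiT : (m t k : ℕ) → Set
IsPiT m t k =
  (Σ (List (LinOrd (1 + m + m))) λ L → (length L ≡ k) × TSeparating m t L) ×
  (∀ (L : List (LinOrd (1 + m + m))) → TSeparating m t L → k ≤ length L)

-- π_f(K_{1,m,m}) = q, i.e. liminf_{t→∞} π_t/t = q (t ranging over t = s+1 ≥ 1),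
-- spelled out with rational ε: π_t is well defined for every t, eventually
-- π_t/t ≥ q - ε, and infinitely often π_t/t ≤ q + ε.
FracSepDimIs : (m : ℕ) → ℚ → Set
FracSepDimIs m q =
  (∀ s → ∃[ k ] IsPiT m (suc s) k) ×
  (∀ (ε : ℚ) → Positive ε → ∃[ N ] ∀ s → N ≤ s → ∀ k → IsPiT m (suc s) k →
       (q - ε) ≤ℚ ((+ k) / suc s)) ×
  (∀ (ε : ℚ) → Positive ε → ∀ N → ∃[ s ] (N ≤ s × ∃[ k ] (IsPiT m (suc s) k ×
       ((+ k) / suc s) ≤ℚ (q +ℚ ε))))

-- 24m / (8m + 5 + 3/(2c-1)) with c = ⌈m/2⌉, written with cleared denominator:
-- 24m(2c-1) / ((8m+5)(2c-1) + 3); the denominator is written suc (… + 2).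
targetValue : ℕ → ℚ
targetValue m = (+ (24 * m * (2 * ⌈ m /2⌉ ∸ 1))) / suc ((8 * m + 5) * (2 * ⌈ m /2⌉ ∸ 1) + 2)

{-# OPTIONS --safe #-}
module Submission where

-- By symmetry only two kinds of pairs of nonincident edges matter: z x | y x′ together with
-- z y | x y′ (z being the vertex of the part of size 1), and x y | x′ y′.
--
-- Lower bound: an ordering separates exactly one of u p | v q and u q | v p, unless p and q lie
-- on the same side of the interval from u to v, when it separates neither.  Hence the number of
-- quadruples {z, y, x, x′} or {z, x, y, y′} without a separated pair is the cost of two lattice
-- paths (the numbers of x's and y's seen so far, read from either end towards z) plus a boundary
-- term.  Its minimum is Σ_{i<m} i² − ⌊m/2⌋⌈m/2⌉, since a cheapest path stays close to the diagonal.
--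
-- Upper bound: the minimum is attained by xyxy…z…xyxy with z in the middle.  Averaging this
-- ordering over all permutations of both parts, and over the exchange of the parts, separates the
-- pairs at z equally often, and the pairs x y | x′ y′ at least as often.

open import Defs
open import Data.Bool using (Bool; true; false; _∧_; _∨_; if_then_else_)
open import Data.Bool.Properties using (∨-comm; ∧-comm; ∧-assoc)
open import Data.Fin using (Fin; zero; suc; toℕ; fromℕ<; punchIn; punchOut; splitAt; _↑ˡ_; _↑ʳ_) renaming (_≟_ to _≟ᶠ_)
open import Data.Fin.Permutation using (Permutation′; _⟨$⟩ʳ_; insert; remove; insert-remove; permutation) renaming (id to idₚ)
open import Data.Fin.Properties using (all?; any?; injective⇒≤; join-splitAt; punchOut-injective; splitAt-↑ˡ; splitAt-↑ʳ; toℕ-fromℕ<; toℕ-injective; toℕ-↑ˡ; toℕ-↑ʳ; toℕ<n; ↑ˡ-injective; ↑ʳ-injective) renaming (suc-injective to suc-injectiveᶠ)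
import Data.Integer as ℤ
import Data.Integer.Properties as ℤ
open import Data.List using (List; []; _∷_; _++_; map; concat; concatMap; replicate; tabulate; length)
open import Data.List.Properties using (length-++)
open import Data.List.Relation.Binary.Pointwise using (Pointwise; []; _∷_)
open import Data.List.Relation.Unary.Any using (Any; here; there; satisfied) renaming (any? to anyList?)
import Data.List.Relation.Unary.Any as Any using (map)
import Data.List.Relation.Unary.Any.Properties as Any
open import Data.Nat hiding (_/_)
open import Data.Nat.Properties
open import Data.Nat.Tactic.RingSolver using (solve-∀)
open import Data.Product using (_×_; _,_; ∃; ∃-syntax; proj₁; proj₂)
open import Data.Rational using (ℚ; _/_; _-_; Positive) renaming (_≤_ to _≤ℚ_; _+_ to _+ℚ_)
import Data.Rational.Properties as ℚ
open import Data.Rational.Unnormalised using (mkℚᵘ; *≤*)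
import Data.Rational.Unnormalised.Properties as ℚᵘ
open import Data.Sum using (_⊎_; inj₁; inj₂; [_,_]′)
open import Data.Unit using (tt)
open import Function using (_∘_)
open import Function.Bundles using (module Injection)
open import Function.Properties.Inverse using (↔⇒↣)
open import Relation.Binary using (tri<; tri≈; tri>)
open import Relation.Binary.PropositionalEquality using (_≡_; _≢_; refl; sym; trans; cong; cong₂; subst; subst₂; module ≡-Reasoning)
open import Relation.Nullary using (¬_; Dec; yes; no; does; contradiction; ¬?; _×-dec_; _→-dec_)
open import Relation.Nullary.Decidable using (map′)
open import Algebra.Properties.Semiring.Sum +-*-semiring using (sum; sum-syntax; sum-cong-≗; sum-remove; ∑-distrib-+; ∑-comm; *-distribˡ-sum; *-distribʳ-sum)

-- Indicators and sums

-- Equal weights on the `2 * (m * c₂ m)` ordered instances of pairs at `z` form an optimal dual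
-- solution, so the answer is that number divided by `hub`, the most that one ordering can separate.
-- If `h` alternating pairs precede `z` and `k` follow it, the costs of both sides and the boundary
-- term add up to `squares (h + k)` minus `2 * (h * k)`: the place of `z` matters only through this
-- product, and maximising it brings `⌈ m /2⌉` into the answer. The obstacle is that a side of `z`
-- may hold more x's than y's; the surplus stays fixed while an induction removes one x and one y
-- from a side at a time. In the upper bound the pairs x y | x′ y′ must not become the bottleneck.
-- This rests on comparing closed forms, `suc n * hub ≤ 2 * bipartite` with `m = 2 + n`, an equality
-- for `m = 2`. The symmetrised family is a finite list, so the value is attained exactly whenever
-- `t` is a multiple of `multiplicity`.

[_] : Bool → ℕ
[ b ] = if b then 1 else 0

<ᵇ-true : ∀ {a b} → a < b → (a <ᵇ b) ≡ true
<ᵇ-true {a} {b} a<b with a <ᵇ b | <⇒<ᵇ a<b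
... | true | _ = refl

<ᵇ-false : ∀ {a b} → b ≤ a → (a <ᵇ b) ≡ false
<ᵇ-false {a} {b} b≤a with a <ᵇ b | <ᵇ⇒< a b
... | false | _ = refl
... | true  | f = contradiction (f tt) (≤⇒≯ b≤a)

[<]-true : ∀ {a b} → a < b → [ a <ᵇ b ] ≡ 1
[<]-true p = cong [_] (<ᵇ-true p)

[<]-false : ∀ {a b} → b ≤ a → [ a <ᵇ b ] ≡ 0
[<]-false p = cong [_] (<ᵇ-false p)

∑-const : ∀ n c → ∑[ i < n ] c ≡ n * c
∑-const zero    c = refl
∑-const (suc n) c = cong (c +_) (∑-const n c)

∑-mono : ∀ {n} {f g : Fin n → ℕ} → (∀ i → f i ≤ g i) → sum f ≤ sum g
∑-mono {zero}  f≤g = z≤n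
∑-mono {suc n} f≤g = +-mono-≤ (f≤g zero) (∑-mono (f≤g ∘ suc))

∑-zero : ∀ {n} {f : Fin n → ℕ} → (∀ i → f i ≡ 0) → sum f ≡ 0
∑-zero {n} f≡0 = trans (sum-cong-≗ f≡0) (trans (∑-const n 0) (*-zeroʳ n))

δ : ∀ {n} → Fin n → Fin n → ℕ
δ i j = [ does (i ≟ᶠ j) ]

δ-refl : ∀ {n} (i : Fin n) → δ i i ≡ 1
δ-refl i with i ≟ᶠ i
... | yes _  = refl
... | no i≢i = contradiction refl i≢i

δ-≢ : ∀ {n} {i j : Fin n} → i ≢ j → δ i j ≡ 0
δ-≢ {i = i} {j} i≢j with i ≟ᶠ j
... | yes i≡j = contradiction i≡j i≢j
... | no _    = refl

∑-δ : ∀ {n} (i : Fin n) → ∑[ j < n ] δ i j ≡ 1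
∑-δ {suc n} zero    = cong suc (∑-zero {n} λ _ → refl)
∑-δ {suc n} (suc i) = ∑-δ i

∑∑-product : ∀ {m n} (f : Fin m → ℕ) (g : Fin n → ℕ) →
             ∑[ i < m ] ∑[ j < n ] (f i * g j) ≡ sum f * sum g
∑∑-product f g = trans (sum-cong-≗ λ i → sym (*-distribˡ-sum (f i) g))
                       (sym (*-distribʳ-sum (sum g) f))

∑∑-distrib-+ : ∀ {m n} (f g : Fin m → Fin n → ℕ) →
  ∑[ i < m ] ∑[ j < n ] (f i j + g i j) ≡ (∑[ i < m ] ∑[ j < n ] f i j) + (∑[ i < m ] ∑[ j < n ] g i j)
∑∑-distrib-+ f g = trans (sum-cong-≗ λ i → ∑-distrib-+ (f i) (g i)) (∑-distrib-+ (λ i → sum (f i)) (λ i → sum (g i)))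

∑∑-diagonal : ∀ {n} (f : Fin n → ℕ) → ∑[ i < n ] ∑[ j < n ] (δ i j * f i) ≡ sum f
∑∑-diagonal f = sum-cong-≗ λ i →
  trans (sym (*-distribʳ-sum (f i) (δ i))) (trans (cong (_* f i) (∑-δ i)) (*-identityˡ (f i)))

-- Twice the number of pairs in a k-element set; all counts below are doubled accordingly.
c₂ : ℕ → ℕ
c₂ zero    = 0
c₂ (suc k) = suc k * k

c₂-square : ∀ k → c₂ k + k ≡ k * k
c₂-square zero    = refl
c₂-square (suc k) = lem k where
  lem : ∀ k → suc k * k + suc k ≡ suc k * suc k
  lem = solve-∀

c₂-suc : ∀ k → c₂ (suc k) ≡ c₂ k + 2 * k
c₂-suc zero    = refl
c₂-suc (suc k) = lem k where
  lem : ∀ k → suc (suc k) * suc k ≡ suc k * k + 2 * suc k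
  lem = solve-∀

-- Separation of four positions

before : ℕ → ℕ → ℕ → ℕ → Bool
before a b c d = (a <ᵇ c) ∧ (a <ᵇ d) ∧ (b <ᵇ c) ∧ (b <ᵇ d)

sep : ℕ → ℕ → ℕ → ℕ → Bool
sep a b c d = before a b c d ∨ before c d a b

∧-swap-pairs : ∀ p q r s → (p ∧ q ∧ r ∧ s) ≡ (r ∧ s ∧ p ∧ q)
∧-swap-pairs p q r s = trans (sym (∧-assoc p q (r ∧ s))) (trans (∧-comm (p ∧ q) (r ∧ s)) (∧-assoc r s (p ∧ q)))

∧-swap-inner : ∀ p q r s → (p ∧ q ∧ r ∧ s) ≡ (q ∧ p ∧ s ∧ r)
∧-swap-inner false false r s = refl
∧-swap-inner false true  r s = refl
∧-swap-inner true  false r s = refl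
∧-swap-inner true  true  r s = ∧-comm r s

sep-swap : ∀ a b c d → sep a b c d ≡ sep c d a b
sep-swap a b c d = ∨-comm (before a b c d) (before c d a b)

sep-flipˡ : ∀ a b c d → sep a b c d ≡ sep b a c d
sep-flipˡ a b c d = cong₂ _∨_ (∧-swap-pairs (a <ᵇ c) (a <ᵇ d) (b <ᵇ c) (b <ᵇ d))
                              (∧-swap-inner (c <ᵇ a) (c <ᵇ b) (d <ᵇ a) (d <ᵇ b))

sep-flipʳ : ∀ a b c d → sep a b c d ≡ sep a b d c
sep-flipʳ a b c d = trans (sep-swap a b c d) (trans (sep-flipˡ c d a b) (sep-swap d c a b))

sep-flips : ∀ a b c d → sep a b c d ≡ sep b a d c
sep-flips a b c d = trans (sep-flipˡ a b c d) (sep-flipʳ b a c d)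

-- Separation would require `b < b`. Incident edges therefore count as unseparated, and the sums
-- below may run over all index pairs, the diagonal included.
sep-incidentʳ : ∀ a b c → sep a b c b ≡ false
sep-incidentʳ a b c rewrite <ᵇ-false (≤-refl {b}) = lem (a <ᵇ c) (a <ᵇ b) (b <ᵇ c) (c <ᵇ a) (c <ᵇ b) (b <ᵇ a)
  where
  lem : ∀ p q r s t u → (p ∧ q ∧ r ∧ false) ∨ (s ∧ t ∧ u ∧ false) ≡ false
  lem p q r s t u = cong₂ _∨_ (z p q r) (z s t u) where
    z : ∀ p q r → (p ∧ q ∧ r ∧ false) ≡ false
    z false q r = refl
    z true false r = refl
    z true true false = refl
    z true true true = refl

sep-incidentˡ : ∀ a b d → sep a b a d ≡ false
sep-incidentˡ a b d = trans (sep-flips a b a d) (sep-incidentʳ b a d)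

sep-left : ∀ {u v p q} → u < v → sep u p v q ≡ before u p v q
sep-left {u} {v} {p} {q} u<v rewrite <ᵇ-false (<⇒≤ u<v) = ∨-false (before u p v q) where
  ∨-false : ∀ b → b ∨ false ≡ b
  ∨-false false = refl
  ∨-false true  = refl

private
  -- With `u < v` and `p < q` only u p | v q can be separated. It fails exactly if `q < u`, when
  -- both points lie below the interval, or `v < p`, when both lie above; these two cases exclude
  -- each other.
  matching-count-< : ∀ {u v p q} → u < v → p ≢ v → q ≢ u → p < q →
    [ sep u p v q ] + [ sep u q v p ] + [ p <ᵇ u ] * [ q <ᵇ u ] + [ v <ᵇ p ] * [ v <ᵇ q ] ≡ 1
  matching-count-< {u} {v} {p} {q} u<v p≢v q≢u p<q
    rewrite sep-left {u} {v} {p} {q} u<v | sep-left {u} {v} {q} {p} u<v | <ᵇ-true u<v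
          | <ᵇ-true p<q | <ᵇ-false (<⇒≤ p<q)
    with <-cmp q u | <-cmp p v
  ... | tri≈ _ e _ | _ = contradiction e q≢u
  ... | _ | tri≈ _ e _ = contradiction e p≢v
  ... | tri< q<u _ _ | _
    rewrite <ᵇ-true q<u | <ᵇ-false (<⇒≤ q<u) | <ᵇ-true (<-trans p<q q<u) | <ᵇ-false (<⇒≤ (<-trans p<q q<u))
          | <ᵇ-false (<⇒≤ (<-trans p<q (<-trans q<u u<v))) = refl
  ... | tri> _ _ u<q | tri< p<v _ _
    rewrite <ᵇ-true u<q | <ᵇ-true p<v | <ᵇ-false (<⇒≤ u<q) | <ᵇ-false (<⇒≤ p<v)
          | *-zeroʳ [ p <ᵇ u ] = lem (u <ᵇ p) (q <ᵇ v)
    where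
    lem : ∀ r s → 1 + [ r ∧ s ∧ false ] + 0 + 0 ≡ 1
    lem false s     = refl
    lem true  false = refl
    lem true  true  = refl
  ... | tri> _ _ u<q | tri> _ _ v<p
    rewrite <ᵇ-true u<q | <ᵇ-false (<⇒≤ u<q) | <ᵇ-true v<p | <ᵇ-false (<⇒≤ v<p) | <ᵇ-true (<-trans v<p p<q)
          | <ᵇ-true (<-trans u<v v<p) | <ᵇ-false (<⇒≤ (<-trans v<p p<q)) | <ᵇ-false (<⇒≤ (<-trans u<v v<p)) = refl

matching-count : ∀ {u v p q} → u < v → p ≢ u → p ≢ v → q ≢ u → q ≢ v → p ≢ q →
  [ sep u p v q ] + [ sep u q v p ] + [ p <ᵇ u ] * [ q <ᵇ u ] + [ v <ᵇ p ] * [ v <ᵇ q ] ≡ 1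
matching-count {u} {v} {p} {q} u<v p≢u p≢v q≢u q≢v p≢q with <-cmp p q
... | tri< p<q _ _ = matching-count-< u<v p≢v q≢u p<q
... | tri≈ _ p≡q _ = contradiction p≡q p≢q
... | tri> _ _ q<p = trans (lem [ sep u p v q ] [ sep u q v p ] [ p <ᵇ u ] [ q <ᵇ u ] [ v <ᵇ p ] [ v <ᵇ q ])
                           (matching-count-< u<v q≢v p≢u q<p)
  where
  lem : ∀ a b c d e f → a + b + c * d + e * f ≡ b + a + d * c + f * e
  lem = solve-∀

-- Edges from two vertices to a common part

below above : ∀ {n} → (Fin n → ℕ) → ℕ → ℕ
below {n} p t = ∑[ i < n ] [ p i <ᵇ t ]
above {n} p t = ∑[ i < n ] [ t <ᵇ p i ]

Inj : ∀ {n} → (Fin n → ℕ) → Set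
Inj p = ∀ {i j} → p i ≡ p j → i ≡ j

Avoids : ∀ {n} → (Fin n → ℕ) → ℕ → Set
Avoids p t = ∀ i → p i ≢ t

[<]-trichotomy : ∀ {a b} → a ≢ b → [ a <ᵇ b ] + [ b <ᵇ a ] ≡ 1
[<]-trichotomy {a} {b} a≢b with <-cmp a b
... | tri< a<b _ _ rewrite <ᵇ-true a<b | <ᵇ-false (<⇒≤ a<b) = refl
... | tri≈ _ a≡b _ = contradiction a≡b a≢b
... | tri> _ _ b<a rewrite <ᵇ-true b<a | <ᵇ-false (<⇒≤ b<a) = refl

below+above : ∀ {n} {p : Fin n → ℕ} {t} → Avoids p t → below p t + above p t ≡ n
below+above {n} {p} {t} p≢t = begin
  below p t + above p t                       ≡⟨ ∑-distrib-+ (λ i → [ p i <ᵇ t ]) (λ i → [ t <ᵇ p i ]) ⟨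
  ∑[ i < n ] ([ p i <ᵇ t ] + [ t <ᵇ p i ])    ≡⟨ sum-cong-≗ (λ i → [<]-trichotomy (p≢t i)) ⟩
  ∑[ i < n ] 1                                ≡⟨ trans (∑-const n 1) (*-identityʳ n) ⟩
  n                                           ∎
  where open ≡-Reasoning

crossings : ∀ {n} → ℕ → ℕ → (Fin n → ℕ) → ℕ
crossings {n} u v p = ∑[ i < n ] ∑[ j < n ] [ sep u (p i) v (p j) ]

crossings-swap : ∀ {n} u v (p : Fin n → ℕ) → crossings u v p ≡ crossings v u p
crossings-swap u v p = trans (∑-comm (λ i j → [ sep u (p i) v (p j) ]))
  (sum-cong-≗ λ j → sum-cong-≗ λ i → cong [_] (sep-swap u (p i) v (p j)))

crossings-self : ∀ {n} u (p : Fin n → ℕ) → crossings u u p ≡ 0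
crossings-self u p = ∑-zero λ i → ∑-zero λ j → cong [_] (sep-incidentˡ u (p i) (p j))

crossings-< : ∀ {n u v} {p : Fin n → ℕ} → Inj p → Avoids p u → Avoids p v → u < v →
              2 * crossings u v p + (c₂ (below p u) + c₂ (above p v)) ≡ c₂ n
crossings-< {n} {u} {v} {p} inj p≢u p≢v u<v = finish (crossings u v p) (below p u) (above p v) (begin
  q + q + a * a + r * r + n
    ≡⟨ cong₂ (λ x y → q + x + y + r * r + n) (∑-comm F′) (∑∑-product A A) ⟨
  ∑∑ F + ∑∑ F′ + ∑∑ (λ i j → A i * A j) + r * r + n
    ≡⟨ cong₂ (λ x y → ∑∑ F + ∑∑ F′ + ∑∑ (λ i j → A i * A j) + x + y) (∑∑-product R R) ∑∑δ ⟨
  ∑∑ F + ∑∑ F′ + ∑∑ (λ i j → A i * A j) + ∑∑ (λ i j → R i * R j) + ∑∑ δ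
    ≡⟨ cong (λ x → x + ∑∑ (λ i j → A i * A j) + ∑∑ (λ i j → R i * R j) + ∑∑ δ) (∑∑-distrib-+ F F′) ⟨
  ∑∑ (λ i j → F i j + F′ i j) + ∑∑ (λ i j → A i * A j) + ∑∑ (λ i j → R i * R j) + ∑∑ δ
    ≡⟨ cong (λ x → x + ∑∑ (λ i j → R i * R j) + ∑∑ δ) (∑∑-distrib-+ (λ i j → F i j + F′ i j) (λ i j → A i * A j)) ⟨
  ∑∑ (λ i j → F i j + F′ i j + A i * A j) + ∑∑ (λ i j → R i * R j) + ∑∑ δ
    ≡⟨ cong (λ x → x + ∑∑ δ) (∑∑-distrib-+ (λ i j → F i j + F′ i j + A i * A j) (λ i j → R i * R j)) ⟨
  ∑∑ (λ i j → F i j + F′ i j + A i * A j + R i * R j) + ∑∑ δ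
    ≡⟨ ∑∑-distrib-+ (λ i j → F i j + F′ i j + A i * A j + R i * R j) δ ⟨
  ∑∑ (λ i j → F i j + F′ i j + A i * A j + R i * R j + δ i j)
    ≡⟨ sum-cong-≗ (λ i → sum-cong-≗ (pointwise i)) ⟩
  ∑∑ (λ i j → 1 + δ i j * (A i + R i))
    ≡⟨ ∑∑-distrib-+ (λ _ _ → 1) (λ i j → δ i j * (A i + R i)) ⟩
  ∑∑ (λ _ _ → 1) + ∑∑ (λ i j → δ i j * (A i + R i))
    ≡⟨ cong₂ _+_ (trans (∑-const n (∑[ j < n ] 1)) (cong (n *_) (trans (∑-const n 1) (*-identityʳ n))))
                 (trans (∑∑-diagonal (λ i → A i + R i)) (∑-distrib-+ A R)) ⟩
  n * n + (a + r) ∎)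
  where
  open ≡-Reasoning
  ∑∑ : (Fin n → Fin n → ℕ) → ℕ
  ∑∑ f = ∑[ i < n ] ∑[ j < n ] f i j
  q = crossings u v p
  a = below p u
  r = above p v
  F F′ : Fin n → Fin n → ℕ
  F i j = [ sep u (p i) v (p j) ]
  F′ i j = [ sep u (p j) v (p i) ]
  A R : Fin n → ℕ
  A i = [ p i <ᵇ u ]
  R i = [ v <ᵇ p i ]
  ∑∑δ : ∑∑ δ ≡ n
  ∑∑δ = trans (sum-cong-≗ {n} ∑-δ) (trans (∑-const n 1) (*-identityʳ n))
  idem : ∀ b → [ b ] * [ b ] ≡ [ b ]
  idem false = refl
  idem true  = refl
  pointwise : ∀ i j → F i j + F′ i j + A i * A j + R i * R j + δ i j ≡ 1 + δ i j * (A i + R i)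
  pointwise i j with i ≟ᶠ j
  ... | yes refl = trans (cong₂ (λ x y → x + x + y + R i * R i + 1) (cong [_] (sep-incidentʳ u (p i) v)) (idem (p i <ᵇ u)))
                  (trans (cong (λ x → A i + x + 1) (idem (v <ᵇ p i))) (lem (A i) (R i)))
    where
    lem : ∀ a r → a + r + 1 ≡ 1 + (a + r + 0)
    lem = solve-∀
  ... | no  i≢j  = cong (_+ 0) (matching-count u<v (p≢u i) (p≢v i) (p≢u j) (p≢v j) (i≢j ∘ inj))
  finish : ∀ q a r → q + q + a * a + r * r + n ≡ n * n + (a + r) → 2 * q + (c₂ a + c₂ r) ≡ c₂ n
  finish q a r eq = +-cancelʳ-≡ (a + r + n) _ _ (begin
    2 * q + (c₂ a + c₂ r) + (a + r + n)         ≡⟨ lem₁ q (c₂ a) (c₂ r) a r n ⟩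
    q + q + (c₂ a + a) + (c₂ r + r) + n         ≡⟨ cong₂ (λ x y → q + q + x + y + n) (c₂-square a) (c₂-square r) ⟩
    q + q + a * a + r * r + n                   ≡⟨ eq ⟩
    n * n + (a + r)                             ≡⟨ cong (_+ (a + r)) (c₂-square n) ⟨
    c₂ n + n + (a + r)                          ≡⟨ lem₂ (c₂ n) n a r ⟩
    c₂ n + (a + r + n)                          ∎)
    where
    lem₁ : ∀ q x y a r n → 2 * q + (x + y) + (a + r + n) ≡ q + q + (x + a) + (y + r) + n
    lem₁ = solve-∀
    lem₂ : ∀ x n a r → x + n + (a + r) ≡ x + (a + r + n)
    lem₂ = solve-∀

-- Lattice paths

partial : (ℕ → ℕ) → ℕ → ℕ
partial f zero    = 0
partial f (suc n) = f n + partial f n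

squares : ℕ → ℕ
squares = partial λ i → 2 * (i * i)

occurrences : ∀ {n} → (Fin n → ℕ) → ℕ → ℕ
occurrences {n} p t = ∑[ i < n ] [ p i ≡ᵇ t ]

≡ᵇ-true : ∀ {a b} → a ≡ b → (a ≡ᵇ b) ≡ true
≡ᵇ-true {a} {b} a≡b with a ≡ᵇ b | ≡⇒≡ᵇ a b a≡b
... | true | _ = refl

≡ᵇ-false : ∀ {a b} → a ≢ b → (a ≡ᵇ b) ≡ false
≡ᵇ-false {a} {b} a≢b with a ≡ᵇ b | ≡ᵇ⇒≡ a b
... | false | _ = refl
... | true  | f = contradiction (f tt) a≢b

occurrences-none : ∀ {n} {p : Fin n → ℕ} {t} → Avoids p t → occurrences p t ≡ 0
occurrences-none p≢t = ∑-zero λ i → cong [_] (≡ᵇ-false (p≢t i))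

occurrences-one : ∀ {n} {p : Fin n → ℕ} → Inj p → ∀ i → occurrences p (p i) ≡ 1
occurrences-one {n} {p} inj i = trans (sum-cong-≗ pointwise) (∑-δ i)
  where
  pointwise : ∀ j → [ p j ≡ᵇ p i ] ≡ δ i j
  pointwise j with i ≟ᶠ j
  ... | yes refl = cong [_] (≡ᵇ-true {p i} refl)
  ... | no i≢j   = cong [_] (≡ᵇ-false (i≢j ∘ sym ∘ inj))

[<]-suc : ∀ a t → [ a <ᵇ suc t ] ≡ [ a <ᵇ t ] + [ a ≡ᵇ t ]
[<]-suc a t with <-cmp a t
... | tri< a<t a≢t _ rewrite <ᵇ-true a<t | <ᵇ-true (m<n⇒m<1+n a<t) | ≡ᵇ-false a≢t = refl
... | tri≈ _ refl _ rewrite <ᵇ-true (n<1+n a) | <ᵇ-false (≤-refl {a}) | ≡ᵇ-true {a} refl = refl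
... | tri> _ a≢t t<a rewrite <ᵇ-false t<a | <ᵇ-false (<⇒≤ t<a) | ≡ᵇ-false a≢t = refl

-- For `f = c₂ ∘ below x` and `p = y` this is what the path pays for its y-steps before position
-- `t`.
sumBelow : ∀ {n} → (ℕ → ℕ) → (Fin n → ℕ) → ℕ → ℕ
sumBelow {n} f p t = ∑[ i < n ] ([ p i <ᵇ t ] * f (p i))

below-suc : ∀ {n} (p : Fin n → ℕ) t → below p (suc t) ≡ below p t + occurrences p t
below-suc p t = trans (sum-cong-≗ λ i → [<]-suc (p i) t) (∑-distrib-+ (λ i → [ p i <ᵇ t ]) (λ i → [ p i ≡ᵇ t ]))

sumBelow-suc : ∀ {n} f (p : Fin n → ℕ) t → sumBelow f p (suc t) ≡ sumBelow f p t + occurrences p t * f t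
sumBelow-suc {n} f p t = begin
  sumBelow f p (suc t)
    ≡⟨ sum-cong-≗ pointwise ⟩
  ∑[ i < n ] ([ p i <ᵇ t ] * f (p i) + [ p i ≡ᵇ t ] * f t)
    ≡⟨ ∑-distrib-+ (λ i → [ p i <ᵇ t ] * f (p i)) (λ i → [ p i ≡ᵇ t ] * f t) ⟩
  sumBelow f p t + ∑[ i < n ] ([ p i ≡ᵇ t ] * f t)
    ≡⟨ cong (sumBelow f p t +_) (*-distribʳ-sum (f t) (λ i → [ p i ≡ᵇ t ])) ⟨
  sumBelow f p t + occurrences p t * f t ∎
  where
  open ≡-Reasoning
  at : ∀ a → [ a ≡ᵇ t ] * f a ≡ [ a ≡ᵇ t ] * f t
  at a with a ≟ t
  ... | yes refl = refl
  ... | no a≢t rewrite ≡ᵇ-false a≢t = refl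
  pointwise : ∀ i → [ p i <ᵇ suc t ] * f (p i) ≡ [ p i <ᵇ t ] * f (p i) + [ p i ≡ᵇ t ] * f t
  pointwise i = trans (cong (_* f (p i)) ([<]-suc (p i) t))
               (trans (*-distribʳ-+ (f (p i)) [ p i <ᵇ t ] [ p i ≡ᵇ t ])
                      (cong ([ p i <ᵇ t ] * f (p i) +_) (at (p i))))

-- A monotone lattice path pays c₂ b for a step (a , b) → (suc a , b) and c₂ a for a step
-- (a , b) → (a , suc b); pathCost a b is the least cost of a path from the origin to (a , b).
pathCost : ℕ → ℕ → ℕ
pathCost zero    b       = 0
pathCost (suc a) zero    = 0
pathCost (suc a) (suc b) = pathCost a b + 2 * (a * b)

pathCost-comm : ∀ a b → pathCost a b ≡ pathCost b a
pathCost-comm zero    zero    = refl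
pathCost-comm zero    (suc b) = refl
pathCost-comm (suc a) zero    = refl
pathCost-comm (suc a) (suc b) = cong₂ (λ x y → x + 2 * y) (pathCost-comm a b) (*-comm a b)

-- Moving along the diagonal adds `2 * (suc a * b)` to both sides, so the inequality reduces to the
-- start of the diagonal, where the left side is zero. Together with its mirror image it makes
-- `pathCost` a potential that no step raises by more than the price of the step.
pathCost-stepˡ : ∀ a b → pathCost (suc a) b ≤ pathCost a b + c₂ b
pathCost-stepˡ a       zero    = z≤n
pathCost-stepˡ zero    (suc b) = z≤n
pathCost-stepˡ (suc a) (suc b) = begin
  pathCost (suc a) b + 2 * (suc a * b)       ≤⟨ +-monoˡ-≤ (2 * (suc a * b)) (pathCost-stepˡ a b) ⟩
  pathCost a b + c₂ b + 2 * (suc a * b)      ≡⟨ lem (pathCost a b) (c₂ b) a b ⟩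
  pathCost a b + 2 * (a * b) + (c₂ b + 2 * b) ≡⟨ cong (pathCost a b + 2 * (a * b) +_) (c₂-suc b) ⟨
  pathCost a b + 2 * (a * b) + c₂ (suc b)    ∎
  where
  open ≤-Reasoning
  lem : ∀ x y a b → x + y + 2 * (suc a * b) ≡ x + 2 * (a * b) + (y + 2 * b)
  lem = solve-∀

pathCost-stepʳ : ∀ a b → pathCost a (suc b) ≤ pathCost a b + c₂ a
pathCost-stepʳ a b rewrite pathCost-comm a (suc b) | pathCost-comm a b = pathCost-stepˡ b a

private
  module _ {m n} {x : Fin m → ℕ} {y : Fin n → ℕ} (x-inj : Inj x) (y-inj : Inj y) (x≢y : ∀ i j → x i ≢ y j) where

    PathBound : ℕ → Set
    PathBound t = pathCost (below x t) (below y t) ≤ sumBelow (c₂ ∘ below x) y t + sumBelow (c₂ ∘ below y) x t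

    -- By injectivity and disjointness at most one vertex of the two parts sits at position `t`, so
    -- the sweep makes at most one lattice step there.
    pathBound-suc : ∀ t → PathBound t → PathBound (suc t)
    pathBound-suc t IH
      rewrite below-suc x t | below-suc y t | sumBelow-suc (c₂ ∘ below x) y t | sumBelow-suc (c₂ ∘ below y) x t
      = step
      where
      a = below x t
      b = below y t
      l = sumBelow (c₂ ∘ below x) y t
      r = sumBelow (c₂ ∘ below y) x t
      open ≤-Reasoning
      step : pathCost (a + occurrences x t) (b + occurrences y t) ≤ l + occurrences y t * c₂ a + (r + occurrences x t * c₂ b)
      step with any? (λ i → x i ≟ t) | any? (λ j → y j ≟ t)
      ... | yes (i , refl) | yes (j , e) = contradiction (sym e) (x≢y i j)
      ... | yes (i , refl) | no ¬y
        rewrite occurrences-one x-inj i | occurrences-none {p = y} {x i} (λ j e → ¬y (j , e)) | +-comm a 1 | +-identityʳ b = begin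
          pathCost (suc a) b            ≤⟨ pathCost-stepˡ a b ⟩
          pathCost a b + c₂ b           ≤⟨ +-monoˡ-≤ (c₂ b) IH ⟩
          l + r + c₂ b                  ≡⟨ lem l r (c₂ b) ⟩
          l + 0 + (r + (c₂ b + 0))      ∎
        where
        lem : ∀ l r c → l + r + c ≡ l + 0 + (r + (c + 0))
        lem = solve-∀
      ... | no ¬x | yes (j , refl)
        rewrite occurrences-one y-inj j | occurrences-none {p = x} {y j} (λ i e → ¬x (i , e)) | +-comm b 1 | +-identityʳ a = begin
          pathCost a (suc b)            ≤⟨ pathCost-stepʳ a b ⟩
          pathCost a b + c₂ a           ≤⟨ +-monoˡ-≤ (c₂ a) IH ⟩
          l + r + c₂ a                  ≡⟨ lem l r (c₂ a) ⟩
          l + (c₂ a + 0) + (r + 0)      ∎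
        where
        lem : ∀ l r c → l + r + c ≡ l + (c + 0) + (r + 0)
        lem = solve-∀
      ... | no ¬x | no ¬y
        rewrite occurrences-none {p = x} {t} (λ i e → ¬x (i , e)) | occurrences-none {p = y} {t} (λ j e → ¬y (j , e))
              | +-identityʳ a | +-identityʳ b | +-identityʳ l | +-identityʳ r = IH

    pathBound : ∀ t → PathBound t
    pathBound zero rewrite ∑-zero {m} {λ i → [ x i <ᵇ 0 ]} (λ i → [<]-false {x i} z≤n) = z≤n
    pathBound (suc t) = pathBound-suc t (pathBound t)

pathCost-≤ : ∀ {m n} {x : Fin m → ℕ} {y : Fin n → ℕ} → Inj x → Inj y → (∀ i j → x i ≢ y j) → ∀ t →
  pathCost (below x t) (below y t) ≤ sumBelow (c₂ ∘ below x) y t + sumBelow (c₂ ∘ below y) x t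
pathCost-≤ = pathBound

-- Minimising over the split of the parts by z

-- Here `a` x's and `b` y's precede `z`, while `a′` and `b′` follow it. The bracket is the boundary
-- term: a y on one side of `z` and two x's on the other give a quadruple without a separated pair,
-- and likewise with x and y exchanged.
halves : ℕ → ℕ → ℕ → ℕ → ℕ
halves a b a′ b′ = pathCost a b + pathCost a′ b′ + (b * c₂ a′ + b′ * c₂ a + (a * c₂ b′ + a′ * c₂ b))

private
  -- The two sides differ by `d * d` minus `d`. Nothing is lost for `d ≤ 1`, that is, for splits
  -- next to the diagonal.
  cross-≤-c₂ : ∀ u d → 2 * (u * (u + d)) ≤ c₂ u + c₂ (u + d) + 2 * u
  cross-≤-c₂ u d = +-cancelʳ-≤ (d) _ _ (begin
    2 * (u * (u + d)) + d               ≤⟨ +-monoʳ-≤ (2 * (u * (u + d))) (m≤m*m d) ⟩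
    2 * (u * (u + d)) + d * d           ≡⟨ lem₁ u d ⟩
    u * u + (u + d) * (u + d)           ≡⟨ cong₂ _+_ (c₂-square u) (c₂-square (u + d)) ⟨
    c₂ u + u + (c₂ (u + d) + (u + d))   ≡⟨ lem₂ (c₂ u) (c₂ (u + d)) u d ⟩
    c₂ u + c₂ (u + d) + 2 * u + d       ∎)
    where
    open ≤-Reasoning
    m≤m*m : ∀ m → m ≤ m * m
    m≤m*m zero    = z≤n
    m≤m*m (suc m) = m≤m*n (suc m) (suc m)
    lem₁ : ∀ u d → 2 * (u * (u + d)) + d * d ≡ u * u + (u + d) * (u + d)
    lem₁ = solve-∀
    lem₂ : ∀ x y u d → x + u + (y + (u + d)) ≡ x + y + 2 * u + d
    lem₂ = solve-∀

-- Meant for the split with `d` x's before `z` and `d` y's after it: both paths are free there, and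
-- only the boundary term is left.
squares-≤ : ∀ d → squares d ≤ d * c₂ d + d * c₂ d
squares-≤ zero    = z≤n
squares-≤ (suc d) = begin
  2 * (d * d) + squares d                          ≤⟨ +-monoʳ-≤ (2 * (d * d)) (squares-≤ d) ⟩
  2 * (d * d) + (d * c₂ d + d * c₂ d)              ≤⟨ m≤m+n _ (2 * (c₂ d + 2 * d) + 2 * (d * d)) ⟩
  2 * (d * d) + (d * c₂ d + d * c₂ d) + (2 * (c₂ d + 2 * d) + 2 * (d * d)) ≡⟨ lem d (c₂ d) ⟩
  suc d * (c₂ d + 2 * d) + suc d * (c₂ d + 2 * d)  ≡⟨ cong (λ c → suc d * c + suc d * c) (c₂-suc d) ⟨
  suc d * c₂ (suc d) + suc d * c₂ (suc d)          ∎
  where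
  open ≤-Reasoning
  lem : ∀ d c → 2 * (d * d) + (d * c + d * c) + (2 * (c + 2 * d) + 2 * (d * d)) ≡ suc d * (c + 2 * d) + suc d * (c + 2 * d)
  lem = solve-∀

-- Reversing the ordering exchanges the sides of `z`; exchanging the parts as well keeps the surplus
-- of x's on the first side, as `HalvesBound` requires.
halves-flip : ∀ a b a′ b′ → halves a b a′ b′ ≡ halves b′ a′ b a
halves-flip a b a′ b′ rewrite pathCost-comm a b | pathCost-comm a′ b′ =
  lem (pathCost b a) (pathCost b′ a′) (b * c₂ a′) (b′ * c₂ a) (a * c₂ b′) (a′ * c₂ b)
  where
  lem : ∀ p q s t u v → p + q + (s + t + (u + v)) ≡ q + p + (v + u + (t + s))
  lem = solve-∀

halves-swap : ∀ a b a′ b′ → halves a b a′ b′ ≡ halves b a b′ a′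
halves-swap a b a′ b′ rewrite pathCost-comm a b | pathCost-comm a′ b′ =
  cong (pathCost b a + pathCost b′ a′ +_) (+-comm (b * c₂ a′ + b′ * c₂ a) (a * c₂ b′ + a′ * c₂ b))

private
  -- Both parts have the same size, so the surplus `d` of x's before `z` equals the surplus of y's
  -- after it. Three parameters thus describe every split with at least as many x's as y's before
  -- `z`.
  HalvesBound : ℕ → ℕ → ℕ → Set
  HalvesBound b u d = squares (b + u + d) ≤ halves (b + d) b u (u + d) + 2 * (b * u)

  -- One more x and one more y before `z`, with `u` and `d` fixed. All increments cancel except
  -- `2 * (u * (u + d))` on the left, which `cross-≤-c₂` absorbs.
  halvesBound-suc : ∀ b u d → HalvesBound b u d → HalvesBound (suc b) u d
  halvesBound-suc b u d IH = begin
    2 * (n * n) + squares n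
      ≤⟨ +-monoʳ-≤ (2 * (n * n)) IH ⟩
    2 * (n * n) + (halves (b + d) b u (u + d) + 2 * (b * u))
      ≡⟨ lem₁ b u d P P′ (c₂ u) (c₂ (b + d)) (c₂ (u + d)) (c₂ b) ⟩
    rest + 2 * (u * (u + d))
      ≤⟨ +-monoʳ-≤ rest (cross-≤-c₂ u d) ⟩
    rest + (c₂ u + c₂ (u + d) + 2 * u)
      ≡⟨ lem₂ b u d P P′ (c₂ u) (c₂ (b + d)) (c₂ (u + d)) (c₂ b) ⟩
    P + 2 * ((b + d) * b) + P′ + (suc b * c₂ u + (u + d) * (c₂ (b + d) + 2 * (b + d)) + (suc (b + d) * c₂ (u + d) + u * (c₂ b + 2 * b))) + 2 * (suc b * u)
      ≡⟨ cong₂ (λ v w → P + 2 * ((b + d) * b) + P′ + (suc b * c₂ u + (u + d) * v + (suc (b + d) * c₂ (u + d) + u * w)) + 2 * (suc b * u)) (c₂-suc (b + d)) (c₂-suc b) ⟨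
    halves (suc b + d) (suc b) u (u + d) + 2 * (suc b * u) ∎
    where
    open ≤-Reasoning
    n = b + u + d
    P = pathCost (b + d) b
    P′ = pathCost u (u + d)
    rest = 2 * ((b + d) * b) + 2 * ((u + d) * (b + d)) + 2 * (u * b) + (P + P′ + (b * c₂ u + (u + d) * c₂ (b + d) + ((b + d) * c₂ (u + d) + u * c₂ b)) + 2 * (b * u))
    lem₁ : ∀ b u d P P′ cu cbd cud cb →
      2 * ((b + u + d) * (b + u + d)) + (P + P′ + (b * cu + (u + d) * cbd + ((b + d) * cud + u * cb)) + 2 * (b * u))
      ≡ 2 * ((b + d) * b) + 2 * ((u + d) * (b + d)) + 2 * (u * b) + (P + P′ + (b * cu + (u + d) * cbd + ((b + d) * cud + u * cb)) + 2 * (b * u)) + 2 * (u * (u + d))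
    lem₁ = solve-∀
    lem₂ : ∀ b u d P P′ cu cbd cud cb →
      2 * ((b + d) * b) + 2 * ((u + d) * (b + d)) + 2 * (u * b) + (P + P′ + (b * cu + (u + d) * cbd + ((b + d) * cud + u * cb)) + 2 * (b * u)) + (cu + cud + 2 * u)
      ≡ P + 2 * ((b + d) * b) + P′ + (suc b * cu + (u + d) * (cbd + 2 * (b + d)) + (suc (b + d) * cud + u * (cb + 2 * b))) + 2 * (suc b * u)
    lem₂ = solve-∀

  halvesBound-+ : ∀ u d → HalvesBound 0 u d → ∀ b → HalvesBound b u d
  halvesBound-+ u d base zero    = base
  halvesBound-+ u d base (suc b) = halvesBound-suc b u d (halvesBound-+ u d base b)

  halvesBound-flip : ∀ b u d → HalvesBound b u d → HalvesBound u b d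
  halvesBound-flip b u d bound
    rewrite halves-flip (u + d) u b (b + d) | +-comm u b | *-comm u b = bound

  halvesBound : ∀ b u d → HalvesBound b u d
  -- The inner induction grows the other side of `z`, seen through the flip; the outer one then
  -- grows `b`.
  halvesBound b u d = halvesBound-+ u d (halvesBound-flip u 0 d (halvesBound-+ 0 d base u)) b
    where
    base : HalvesBound 0 0 d
    base = ≤-trans (squares-≤ d) (≤-reflexive (lem (pathCost d 0) (pathCost-comm d 0) (d * c₂ d)))
      where
      lem : ∀ p → p ≡ 0 → ∀ c → c + c ≡ p + 0 + (c + (c + 0)) + 0
      lem .0 refl = solve-∀

balance : ℕ → ℕ
balance m = ⌊ m /2⌋ * ⌈ m /2⌉

-- Increasing both factors by one increases either product by the sum of its factors plus one, and
-- the two sums agree.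
product-≤-balance : ∀ b u → b * u ≤ balance (b + u)
product-≤-balance zero    u       = z≤n
product-≤-balance (suc b) zero    rewrite *-zeroʳ b = z≤n
product-≤-balance (suc b) (suc u) rewrite +-suc b u = begin
  suc b * suc u                             ≡⟨ lem b u ⟩
  suc (b + u) + b * u                       ≤⟨ +-monoʳ-≤ (suc (b + u)) (product-≤-balance b u) ⟩
  suc (b + u) + f * c                       ≡⟨ cong (λ n → suc n + f * c) (⌊n/2⌋+⌈n/2⌉≡n (b + u)) ⟨
  suc (f + c) + f * c                       ≡⟨ lem f c ⟨
  suc f * suc c                             ∎
  where
  open ≤-Reasoning
  f = ⌊ b + u /2⌋
  c = ⌈ b + u /2⌉
  lem : ∀ b u → suc b * suc u ≡ suc (b + u) + b * u
  lem = solve-∀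

balance-mono : ∀ {m n} → m ≤ n → balance m ≤ balance n
balance-mono m≤n = *-mono-≤ (⌊n/2⌋-mono m≤n) (⌈n/2⌉-mono m≤n)

private
  squares-≤-halves′ : ∀ {m} b d a′ b′ → b + d + a′ ≡ m → b + b′ ≡ m → squares m ≤ halves (b + d) b a′ b′ + 2 * balance m
  squares-≤-halves′ {m} b d a′ b′ refl e with +-cancelˡ-≡ b b′ (a′ + d) (trans e (lem b d a′))
    where
    lem : ∀ b d a → b + d + a ≡ b + (a + d)
    lem = solve-∀
  ... | refl = begin
    squares (b + d + a′)                          ≡⟨ cong squares (lem b d a′) ⟩
    squares (b + a′ + d)                          ≤⟨ halvesBound b a′ d ⟩
    halves (b + d) b a′ (a′ + d) + 2 * (b * a′)   ≤⟨ +-monoʳ-≤ (halves (b + d) b a′ (a′ + d)) (*-monoʳ-≤ 2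
                                                      (≤-trans (product-≤-balance b a′) (balance-mono (≤-trans (m≤m+n (b + a′) d) (≤-reflexive (sym (lem b d a′))))))) ⟩
    halves (b + d) b a′ (a′ + d) + 2 * balance (b + d + a′) ∎
    where
    open ≤-Reasoning
    lem : ∀ b d a → b + d + a ≡ b + a + d
    lem = solve-∀

squares-≤-halves : ∀ {m} a b a′ b′ → a + a′ ≡ m → b + b′ ≡ m → squares m ≤ halves a b a′ b′ + 2 * balance m
squares-≤-halves a b a′ b′ e e′ with ≤-total b a
... | inj₁ b≤a with m≤n⇒∃[o]m+o≡n b≤a
...   | d , refl = squares-≤-halves′ b d a′ b′ e e′
squares-≤-halves a b a′ b′ e e′ | inj₂ a≤b with m≤n⇒∃[o]m+o≡n a≤b
...   | d , refl rewrite halves-swap a (a + d) a′ b′ = squares-≤-halves′ a d b′ a′ e′ e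

-- Upper bound on the separated pairs at z

sumAbove : ∀ {n} → (ℕ → ℕ) → (Fin n → ℕ) → ℕ → ℕ
sumAbove {n} f p t = ∑[ i < n ] ([ t <ᵇ p i ] * f (p i))

-- `crossings-<` summed over the y's, on the interval from `y j` to `z` or from `z` to `y j`. In
-- either case one of the two `c₂` terms is the price of the y-step (`A`, `B`), and the other
-- concerns the x's beyond `z` (`D`, `E`).
hub-identity-half : ∀ {m n} {x : Fin m → ℕ} {y : Fin n → ℕ} {z} →
  Inj x → (∀ i j → x i ≢ y j) → Avoids x z → Avoids y z →
  2 * ∑[ j < n ] crossings z (y j) x
    + (sumBelow (c₂ ∘ below x) y z + sumAbove (c₂ ∘ above x) y z
       + (below y z * c₂ (above x z) + above y z * c₂ (below x z)))
  ≡ n * c₂ m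
hub-identity-half {m} {n} {x} {y} {z} x-inj x≢y x≢z y≢z = begin
  2 * sum C + (sum A + sum B + (below y z * c₂ (above x z) + above y z * c₂ (below x z)))
    ≡⟨ cong₂ (λ s t → s + (sum A + sum B + t)) (*-distribˡ-sum 2 C)
         (cong₂ _+_ (*-distribʳ-sum (c₂ (above x z)) (λ j → [ y j <ᵇ z ]))
                    (*-distribʳ-sum (c₂ (below x z)) (λ j → [ z <ᵇ y j ]))) ⟩
  sum (λ j → 2 * C j) + (sum A + sum B + (sum D + sum E))
    ≡⟨ cong₂ (λ s t → sum (λ j → 2 * C j) + (s + t)) (∑-distrib-+ A B) (∑-distrib-+ D E) ⟨
  sum (λ j → 2 * C j) + (sum (λ j → A j + B j) + sum (λ j → D j + E j))
    ≡⟨ cong (sum (λ j → 2 * C j) +_) (∑-distrib-+ (λ j → A j + B j) (λ j → D j + E j)) ⟨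
  sum (λ j → 2 * C j) + sum (λ j → A j + B j + (D j + E j))
    ≡⟨ ∑-distrib-+ (λ j → 2 * C j) (λ j → A j + B j + (D j + E j)) ⟨
  sum (λ j → 2 * C j + (A j + B j + (D j + E j)))
    ≡⟨ sum-cong-≗ pointwise ⟩
  ∑[ j < n ] c₂ m
    ≡⟨ ∑-const n (c₂ m) ⟩
  n * c₂ m ∎
  where
  open ≡-Reasoning
  A B C D E : Fin n → ℕ
  A j = [ y j <ᵇ z ] * c₂ (below x (y j))
  B j = [ z <ᵇ y j ] * c₂ (above x (y j))
  C j = crossings z (y j) x
  D j = [ y j <ᵇ z ] * c₂ (above x z)
  E j = [ z <ᵇ y j ] * c₂ (below x z)
  pointwise : ∀ j → 2 * C j + (A j + B j + (D j + E j)) ≡ c₂ m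
  pointwise j with <-cmp (y j) z
  ... | tri≈ _ e _ = contradiction e (y≢z j)
  ... | tri< y<z _ _ =
    trans (lem (C j) (c₂ (below x (y j))) (c₂ (above x (y j))) (c₂ (above x z)) (c₂ (below x z))
               ([<]-true y<z) ([<]-false (<⇒≤ y<z)))
   (trans (cong (λ q → 2 * q + (c₂ (below x (y j)) + c₂ (above x z))) (crossings-swap z (y j) x))
          (crossings-< x-inj (λ i → x≢y i j) x≢z y<z))
    where
    lem : ∀ q a b d e {s t} → s ≡ 1 → t ≡ 0 → 2 * q + (s * a + t * b + (s * d + t * e)) ≡ 2 * q + (a + d)
    lem q a b d e refl refl = ring q a d where
      ring : ∀ q a d → 2 * q + (a + 0 + 0 + (d + 0 + 0)) ≡ 2 * q + (a + d)
      ring = solve-∀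
  ... | tri> _ _ z<y =
    trans (lem (C j) (c₂ (below x (y j))) (c₂ (above x (y j))) (c₂ (above x z)) (c₂ (below x z))
               ([<]-false (<⇒≤ z<y)) ([<]-true z<y))
          (crossings-< x-inj x≢z (λ i → x≢y i j) z<y)
    where
    lem : ∀ q a b d e {s t} → s ≡ 0 → t ≡ 1 → 2 * q + (s * a + t * b + (s * d + t * e)) ≡ 2 * q + (e + b)
    lem q a b d e refl refl = ring q b e where
      ring : ∀ q b e → 2 * q + (b + 0 + (e + 0)) ≡ 2 * q + (e + b)
      ring = solve-∀

-- Positions of the vertices of K_{1,m,m} in a linear ordering: z for the part of size 1,
-- x and y for the parts of size m.
record Layout (m : ℕ) : Set where
  field
    z        : ℕ
    x y      : Fin m → ℕ
    x-inj    : Inj x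
    y-inj    : Inj y
    x≢y      : ∀ i j → x i ≢ y j
    x≢z      : Avoids x z
    y≢z      : Avoids y z
    bound    : ℕ
    x≤bound  : ∀ i → x i ≤ bound
    y≤bound  : ∀ i → y i ≤ bound
    z≤bound  : z ≤ bound

∸-reverses-<ᵇ : ∀ {N a b} → a ≤ N → b ≤ N → (N ∸ a <ᵇ N ∸ b) ≡ (b <ᵇ a)
∸-reverses-<ᵇ {N} {a} {b} a≤N b≤N with ≤-total a b
... | inj₁ a≤b = trans (<ᵇ-false (∸-monoʳ-≤ N a≤b)) (sym (<ᵇ-false a≤b))
... | inj₂ b≤a with <-cmp b a
...   | tri< b<a _ _ = trans (<ᵇ-true (∸-monoʳ-< b<a a≤N)) (sym (<ᵇ-true b<a))
...   | tri≈ _ refl _ = trans (<ᵇ-false (≤-refl {N ∸ a})) (sym (<ᵇ-false (≤-refl {a})))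
...   | tri> _ _ a<b = contradiction a<b (≤⇒≯ b≤a)

module _ {m} (ℓ : Layout m) where
  open Layout ℓ

  hubCrossings : ℕ
  hubCrossings = ∑[ j < m ] crossings z (y j) x + ∑[ i < m ] crossings z (x i) y

  -- Twice the number of quadruples without a separated pair at `z`: the path before `z`, the path
  -- after `z`, and the boundary term.
  defect : ℕ
  defect = sumBelow (c₂ ∘ below x) y z + sumBelow (c₂ ∘ below y) x z
         + (sumAbove (c₂ ∘ above x) y z + sumAbove (c₂ ∘ above y) x z)
         + (below y z * c₂ (above x z) + above y z * c₂ (below x z)
            + (below x z * c₂ (above y z) + above x z * c₂ (below y z)))

  hub-identity : 2 * hubCrossings + defect ≡ 2 * (m * c₂ m)
  hub-identity = trans
    (lem (∑[ j < m ] crossings z (y j) x) (∑[ i < m ] crossings z (x i) y)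
         (sumBelow (c₂ ∘ below x) y z) (sumBelow (c₂ ∘ below y) x z)
         (sumAbove (c₂ ∘ above x) y z) (sumAbove (c₂ ∘ above y) x z)
         (below y z * c₂ (above x z) + above y z * c₂ (below x z))
         (below x z * c₂ (above y z) + above x z * c₂ (below y z)))
    (trans (cong₂ _+_ (hub-identity-half x-inj x≢y x≢z y≢z)
                      (hub-identity-half y-inj (λ j i e → x≢y i j (sym e)) y≢z x≢z))
           (cong (m * c₂ m +_) (sym (+-identityʳ (m * c₂ m)))))
    where
    lem : ∀ p q a b c d e f → 2 * (p + q) + (a + b + (c + d) + (e + f)) ≡ 2 * p + (a + c + e) + (2 * q + (b + d + f))
    lem = solve-∀

  private
    flip : ∀ {n} → (Fin n → ℕ) → Fin n → ℕ
    flip p i = bound ∸ p i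

    flip-inj : ∀ {n} {p : Fin n → ℕ} → (∀ i → p i ≤ bound) → Inj p → Inj (flip p)
    flip-inj p≤ inj {i} {j} e = inj (∸-cancelˡ-≡ (p≤ i) (p≤ j) e)

    below-flip : ∀ {n} {p : Fin n → ℕ} {t} → (∀ i → p i ≤ bound) → t ≤ bound → below (flip p) (bound ∸ t) ≡ above p t
    below-flip p≤ t≤ = sum-cong-≗ λ i → cong [_] (∸-reverses-<ᵇ (p≤ i) t≤)

    sumBelow-flip : ∀ {n} {x y : Fin n → ℕ} → (∀ i → x i ≤ bound) → (∀ i → y i ≤ bound) →
                    sumBelow (c₂ ∘ below (flip x)) (flip y) (bound ∸ z) ≡ sumAbove (c₂ ∘ above x) y z
    sumBelow-flip x≤ y≤ = sum-cong-≗ λ j →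
      cong₂ _*_ (cong [_] (∸-reverses-<ᵇ (y≤ j) z≤bound)) (cong c₂ (below-flip x≤ (y≤ j)))

  -- The reflection of `t` to `bound ∸ t` turns the positions after `z` into an initial segment, to
  -- which `pathCost-≤` applies; this is the purpose of `bound` in a `Layout`.
  pathCost-≤-above : pathCost (above x z) (above y z) ≤ sumAbove (c₂ ∘ above x) y z + sumAbove (c₂ ∘ above y) x z
  pathCost-≤-above = subst₂ _≤_
    (cong₂ pathCost (below-flip x≤bound z≤bound) (below-flip y≤bound z≤bound))
    (cong₂ _+_ (sumBelow-flip x≤bound y≤bound) (sumBelow-flip y≤bound x≤bound))
    (pathCost-≤ (flip-inj x≤bound x-inj) (flip-inj y≤bound y-inj)
                (λ i j e → x≢y i j (∸-cancelˡ-≡ (x≤bound i) (y≤bound j) e)) (bound ∸ z))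

  squares-≤-defect : squares m ≤ defect + 2 * balance m
  squares-≤-defect = ≤-trans
    (squares-≤-halves (below x z) (below y z) (above x z) (above y z) (below+above x≢z) (below+above y≢z))
    (+-monoˡ-≤ (2 * balance m) (+-monoˡ-≤ _ (+-mono-≤ (pathCost-≤ x-inj y-inj x≢y z) pathCost-≤-above)))

  hubCrossings-≤ : 2 * hubCrossings + squares m ≤ 2 * (m * c₂ m) + 2 * balance m
  hubCrossings-≤ = begin
    2 * hubCrossings + squares m                     ≤⟨ +-monoʳ-≤ (2 * hubCrossings) squares-≤-defect ⟩
    2 * hubCrossings + (defect + 2 * balance m)      ≡⟨ +-assoc (2 * hubCrossings) defect (2 * balance m) ⟨
    2 * hubCrossings + defect + 2 * balance m        ≡⟨ cong (_+ 2 * balance m) hub-identity ⟩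
    2 * (m * c₂ m) + 2 * balance m                   ∎
    where open ≤-Reasoning

-- The balanced ordering

partial-cong : ∀ {f g : ℕ → ℕ} → (∀ i → f i ≡ g i) → ∀ n → partial f n ≡ partial g n
partial-cong f≡g zero    = refl
partial-cong f≡g (suc n) = cong₂ _+_ (f≡g n) (partial-cong f≡g n)

partial-+ : ∀ f g n → partial f n + partial g n ≡ partial (λ i → f i + g i) n
partial-+ f g zero    = refl
partial-+ f g (suc n) = trans (lem (f n) (partial f n) (g n) (partial g n)) (cong (f n + g n +_) (partial-+ f g n))
  where
  lem : ∀ a b c d → a + b + (c + d) ≡ a + c + (b + d)
  lem = solve-∀

partial-head : ∀ f n → partial f (suc n) ≡ f 0 + partial (f ∘ suc) n
partial-head f zero    = refl
partial-head f (suc n) = trans (cong (f (suc n) +_) (partial-head f n))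
  (lem (f (suc n)) (f 0) (partial (f ∘ suc) n))
  where
  lem : ∀ a b c → a + (b + c) ≡ b + (a + c)
  lem = solve-∀

partial-one : ∀ n → partial (λ _ → 1) n ≡ n
partial-one zero    = refl
partial-one (suc n) = cong suc (partial-one n)

∑-initial : ∀ f {n t} → t ≤ n → ∑[ i < n ] ([ toℕ i <ᵇ t ] * f (toℕ i)) ≡ partial f t
∑-initial f {n} z≤n = ∑-zero {n} λ _ → refl
∑-initial f {suc n} {suc t} (s≤s t≤n) =
  trans (cong₂ _+_ (*-identityˡ (f 0)) (∑-initial (f ∘ suc) t≤n)) (sym (partial-head f t))

∑-final : ∀ f n h → ∑[ i < n ] ([ h <ᵇ suc (toℕ i) ] * f (n ∸ suc (toℕ i))) ≡ partial f (n ∸ h)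
∑-final f zero    h       rewrite 0∸n≡0 h = refl
∑-final f (suc n) zero    = cong₂ _+_ (*-identityˡ (f n)) (∑-final f n zero)
∑-final f (suc n) (suc h) = ∑-final f n h

∑-partial : ∀ f n → ∑[ i < n ] f (toℕ i) ≡ partial f n
∑-partial f n = trans (sum-cong-≗ {n} λ i → sym (trans (cong (_* f (toℕ i)) ([<]-true (toℕ<n i))) (*-identityˡ _)))
                      (∑-initial f {n} {n} ≤-refl)

c₂-pair : ∀ k → c₂ (suc k) + c₂ k ≡ 2 * (k * k)
c₂-pair k = +-cancelʳ-≡ k _ _ (trans (+-assoc (c₂ (suc k)) (c₂ k) k)
  (trans (cong (c₂ (suc k) +_) (c₂-square k)) (lem k)))
  where
  lem : ∀ k → suc k * k + k * k ≡ 2 * (k * k) + k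
  lem = solve-∀

-- In x₀ y₀ x₁ y₁ ... the vertex xᵢ has `i` y's before it and yᵢ has `suc i` x's before it, so the
-- i-th pair pays `c₂ i + c₂ (suc i)`, the summand of `squares`.
partial-c₂ : ∀ n → partial (c₂ ∘ suc) n + partial c₂ n ≡ squares n
partial-c₂ n = trans (partial-+ (c₂ ∘ suc) c₂ n) (partial-cong c₂-pair n)

-- The equality case of the bound on `halves`, with `h` alternating pairs before `z` and `k` after
-- it. Being valid for every such split, it isolates `h * k` as the quantity to maximise.
squares-+ : ∀ h k → squares h + squares k + (h * c₂ k + k * c₂ h + (h * c₂ k + k * c₂ h)) + 2 * (h * k) ≡ squares (h + k)
squares-+ zero    k = lem (squares k) k
  where
  lem : ∀ s k → s + (k * 0 + k * 0) + 0 ≡ s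
  lem = solve-∀
squares-+ (suc h) k = begin
  2 * (h * h) + squares h + squares k + (suc h * c₂ k + k * c₂ (suc h) + (suc h * c₂ k + k * c₂ (suc h))) + 2 * (suc h * k)
    ≡⟨ cong (λ c → 2 * (h * h) + squares h + squares k + (suc h * c₂ k + k * c + (suc h * c₂ k + k * c)) + 2 * (suc h * k)) (c₂-suc h) ⟩
  2 * (h * h) + squares h + squares k + (suc h * c₂ k + k * (c₂ h + 2 * h) + (suc h * c₂ k + k * (c₂ h + 2 * h))) + 2 * (suc h * k)
    ≡⟨ lem₁ h k (squares h) (squares k) (c₂ h) (c₂ k) ⟩
  2 * (h * h) + 4 * (h * k) + 2 * (c₂ k + k) + (squares h + squares k + (h * c₂ k + k * c₂ h + (h * c₂ k + k * c₂ h)) + 2 * (h * k))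
    ≡⟨ cong₂ (λ s t → 2 * (h * h) + 4 * (h * k) + 2 * s + t) (c₂-square k) (squares-+ h k) ⟩
  2 * (h * h) + 4 * (h * k) + 2 * (k * k) + squares (h + k)
    ≡⟨ cong (_+ squares (h + k)) (lem₂ h k) ⟩
  squares (suc h + k) ∎
  where
  open ≡-Reasoning
  lem₁ : ∀ h k s t c d → 2 * (h * h) + s + t + (suc h * d + k * (c + 2 * h) + (suc h * d + k * (c + 2 * h))) + 2 * (suc h * k)
    ≡ 2 * (h * h) + 4 * (h * k) + 2 * (d + k) + (s + t + (h * d + k * c + (h * d + k * c)) + 2 * (h * k))
  lem₁ = solve-∀
  lem₂ : ∀ h k → 2 * (h * h) + 4 * (h * k) + 2 * (k * k) ≡ 2 * ((h + k) * (h + k))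
  lem₂ = solve-∀

<ᵇ-cong : ∀ {a b c d} → (a < b → c < d) → (b ≤ a → d ≤ c) → (a <ᵇ b) ≡ (c <ᵇ d)
<ᵇ-cong {a} {b} lt ge with <-cmp a b
... | tri< a<b _ _ = trans (<ᵇ-true a<b) (sym (<ᵇ-true (lt a<b)))
... | tri≈ _ a≡b _ = trans (<ᵇ-false (≤-reflexive (sym a≡b))) (sym (<ᵇ-false (ge (≤-reflexive (sym a≡b)))))
... | tri> _ _ b<a = trans (<ᵇ-false (<⇒≤ b<a)) (sym (<ᵇ-false (ge (<⇒≤ b<a))))

-- The ordering x₀ y₀ x₁ y₁ … with z inserted after the first ⌊m/2⌋ pairs.
module Balanced (m : ℕ) where
  h h′ : ℕ
  h  = ⌊ m /2⌋
  h′ = ⌈ m /2⌉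

  h+h′≡m : h + h′ ≡ m
  h+h′≡m = ⌊n/2⌋+⌈n/2⌉≡n m

  h≤m : h ≤ m
  h≤m = ⌊n/2⌋≤n m

  m∸h≡h′ : m ∸ h ≡ h′
  m∸h≡h′ = trans (cong (_∸ h) (sym h+h′≡m)) (m+n∸m≡n h h′)

  -- `h <ᵇ suc i` stands for `h ≤ i`: from index `h` on, the pairs move up by one place, which
  -- leaves the position `h + h` free for `z`.
  shift slot : ℕ → ℕ
  shift i = [ h <ᵇ suc i ]
  slot i = i + i + shift i

  kz : ℕ
  kz = h + h

  kx ky : Fin m → ℕ
  kx i = slot (toℕ i)
  ky i = suc (slot (toℕ i))

  shift-mono : ∀ {i j} → i ≤ j → shift i ≤ shift j
  shift-mono {i} {j} i≤j with h ≤? i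
  ... | yes h≤i rewrite <ᵇ-true (s≤s h≤i) | <ᵇ-true (s≤s (≤-trans h≤i i≤j)) = ≤-refl
  ... | no  h≰i rewrite <ᵇ-false (≰⇒> h≰i) = z≤n

  slot-< : ∀ {i j} → i < j → suc (slot i) < slot j
  slot-< {i} {j} i<j = begin
    suc (suc (i + i + shift i))   ≡⟨ cong (λ n → suc (n + shift i)) (sym (+-suc i i)) ⟩
    suc i + suc i + shift i       ≤⟨ +-mono-≤ (+-mono-≤ i<j i<j) (shift-mono (<⇒≤ i<j)) ⟩
    j + j + shift j               ∎
    where open ≤-Reasoning

  slot-mono : ∀ {i j} → i ≤ j → slot i ≤ slot j
  slot-mono i≤j = +-mono-≤ (+-mono-≤ i≤j i≤j) (shift-mono i≤j)

  slot-left : ∀ {i} → i < h → suc (slot i) < kz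
  slot-left {i} i<h rewrite <ᵇ-false i<h | +-identityʳ (i + i) | sym (+-suc i i) = +-mono-≤ i<h i<h

  slot-right : ∀ {i} → h ≤ i → kz < slot i
  slot-right {i} h≤i rewrite <ᵇ-true (s≤s h≤i) | +-comm (i + i) 1 = s≤s (+-mono-≤ h≤i h≤i)

  slot-bound : ∀ {i} → i < m → suc (slot i) ≤ m + m
  slot-bound {i} i<m = begin
    suc (i + i + shift i)  ≤⟨ s≤s (+-monoʳ-≤ (i + i) (shift≤1 i)) ⟩
    suc (i + i + 1)        ≡⟨ cong suc (trans (+-comm (i + i) 1) (sym (+-suc i i))) ⟩
    suc i + suc i          ≤⟨ +-mono-≤ i<m i<m ⟩
    m + m                  ∎
    where
    open ≤-Reasoning
    shift≤1 : ∀ i → shift i ≤ 1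
    shift≤1 i with h <ᵇ suc i
    ... | false = z≤n
    ... | true  = ≤-refl

  slot-inj : ∀ {i j} → slot i ≡ slot j → i ≡ j
  slot-inj {i} {j} e with <-cmp i j
  ... | tri< i<j _ _ = contradiction e (<⇒≢ (<-trans (n<1+n _) (slot-< i<j)))
  ... | tri≈ _ i≡j _ = i≡j
  ... | tri> _ _ j<i = contradiction (sym e) (<⇒≢ (<-trans (n<1+n _) (slot-< j<i)))

  slot≢suc-slot : ∀ i j → slot i ≢ suc (slot j)
  slot≢suc-slot i j e with i ≤? j
  ... | yes i≤j = <⇒≢ (s≤s (slot-mono i≤j)) e
  ... | no  i≰j = <⇒≢ (slot-< (≰⇒> i≰j)) (sym e)

  slot≢kz : ∀ i → slot i ≢ kz
  slot≢kz i e with h ≤? i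
  ... | yes h≤i = <⇒≢ (slot-right h≤i) (sym e)
  ... | no  h≰i = <⇒≢ (<-trans (n<1+n _) (slot-left (≰⇒> h≰i))) e

  suc-slot≢kz : ∀ i → suc (slot i) ≢ kz
  suc-slot≢kz i e with h ≤? i
  ... | yes h≤i = <⇒≢ (m<n⇒m<1+n (slot-right h≤i)) (sym e)
  ... | no  h≰i = <⇒≢ (slot-left (≰⇒> h≰i)) e

  layout : Layout m
  layout = record
    { z = kz
    ; x = kx
    ; y = ky
    ; x-inj = toℕ-injective ∘ slot-inj
    ; y-inj = toℕ-injective ∘ slot-inj ∘ suc-injective
    ; x≢y = λ i j → slot≢suc-slot (toℕ i) (toℕ j)
    ; x≢z = slot≢kz ∘ toℕ
    ; y≢z = suc-slot≢kz ∘ toℕ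
    ; bound = m + m
    ; x≤bound = λ i → <⇒≤ (slot-bound (toℕ<n i))
    ; y≤bound = λ i → slot-bound (toℕ<n i)
    ; z≤bound = +-mono-≤ h≤m h≤m
    }

  x<y : ∀ i j → (slot i <ᵇ suc (slot j)) ≡ (i <ᵇ suc j)
  x<y i j = sym (<ᵇ-cong {i} {suc j} (λ i<1+j → s≤s (slot-mono (≤-pred i<1+j))) (λ j<i → <⇒≤ (slot-< j<i)))

  y<x : ∀ i j → (suc (slot j) <ᵇ slot i) ≡ (j <ᵇ i)
  y<x i j = sym (<ᵇ-cong {j} {i} slot-< (λ i≤j → m≤n⇒m≤1+n (slot-mono i≤j)))

  x<z : ∀ i → (slot i <ᵇ kz) ≡ (i <ᵇ h)
  x<z i = sym (<ᵇ-cong (λ i<h → <-trans (n<1+n _) (slot-left i<h)) (<⇒≤ ∘ slot-right))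

  y<z : ∀ i → (suc (slot i) <ᵇ kz) ≡ (i <ᵇ h)
  y<z i = sym (<ᵇ-cong slot-left (λ h≤i → m≤n⇒m≤1+n (<⇒≤ (slot-right h≤i))))

  z<x : ∀ i → (kz <ᵇ slot i) ≡ (h <ᵇ suc i)
  z<x i = sym (<ᵇ-cong (slot-right ∘ ≤-pred) (λ i<h → <⇒≤ (<-trans (n<1+n _) (slot-left i<h))))

  z<y : ∀ i → (kz <ᵇ suc (slot i)) ≡ (h <ᵇ suc i)
  z<y i = sym (<ᵇ-cong (m<n⇒m<1+n ∘ slot-right ∘ ≤-pred) (<⇒≤ ∘ slot-left))

  count-initial : ∀ {t} {p : Fin m → Bool} → t ≤ m → (∀ i → p i ≡ (toℕ i <ᵇ t)) → ∑[ i < m ] [ p i ] ≡ t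
  count-initial {t} t≤m eq = trans (sum-cong-≗ {m} λ i → trans (cong [_] (eq i)) (sym (*-identityʳ [ toℕ i <ᵇ t ])))
                                   (trans (∑-initial (λ _ → 1) t≤m) (partial-one t))

  count-final : ∀ t {p : Fin m → Bool} → (∀ i → p i ≡ (t <ᵇ suc (toℕ i))) → ∑[ i < m ] [ p i ] ≡ m ∸ t
  count-final t eq = trans (sum-cong-≗ {m} λ i → trans (cong [_] (eq i)) (sym (*-identityʳ [ t <ᵇ suc (toℕ i) ])))
                           (trans (∑-final (λ _ → 1) m t) (partial-one (m ∸ t)))

  below-x-y : ∀ j → below kx (ky j) ≡ suc (toℕ j)
  below-x-y j = count-initial (toℕ<n j) λ i → x<y (toℕ i) (toℕ j)

  below-y-x : ∀ i → below ky (kx i) ≡ toℕ i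
  below-y-x i = count-initial (<⇒≤ (toℕ<n i)) λ j → y<x (toℕ i) (toℕ j)

  above-x-y : ∀ j → above kx (ky j) ≡ m ∸ suc (toℕ j)
  above-x-y j = count-final (suc (toℕ j)) λ i → y<x (toℕ i) (toℕ j)

  above-y-x : ∀ i → above ky (kx i) ≡ suc (m ∸ suc (toℕ i))
  above-y-x i = trans (count-final (toℕ i) λ j → x<y (toℕ i) (toℕ j)) (+-∸-assoc 1 (toℕ<n i))

  below-x-z : below kx kz ≡ h
  below-x-z = count-initial h≤m λ i → x<z (toℕ i)

  below-y-z : below ky kz ≡ h
  below-y-z = count-initial h≤m λ i → y<z (toℕ i)

  above-x-z : above kx kz ≡ h′
  above-x-z = trans (count-final h λ i → z<x (toℕ i)) m∸h≡h′

  above-y-z : above ky kz ≡ h′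
  above-y-z = trans (count-final h λ i → z<y (toℕ i)) m∸h≡h′

  sumBelow-squares : sumBelow (c₂ ∘ below kx) ky kz + sumBelow (c₂ ∘ below ky) kx kz ≡ squares h
  sumBelow-squares = trans
    (cong₂ _+_
      (trans (sum-cong-≗ λ j → cong₂ _*_ (cong [_] (y<z (toℕ j))) (cong c₂ (below-x-y j))) (∑-initial (c₂ ∘ suc) h≤m))
      (trans (sum-cong-≗ λ i → cong₂ _*_ (cong [_] (x<z (toℕ i))) (cong c₂ (below-y-x i))) (∑-initial c₂ h≤m)))
    (partial-c₂ h)

  sumAbove-squares : sumAbove (c₂ ∘ above kx) ky kz + sumAbove (c₂ ∘ above ky) kx kz ≡ squares h′
  sumAbove-squares = trans
    (cong₂ _+_
      (trans (sum-cong-≗ λ j → cong₂ _*_ (cong [_] (z<y (toℕ j))) (cong c₂ (above-x-y j))) (∑-final c₂ m h))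
      (trans (sum-cong-≗ λ i → cong₂ _*_ (cong [_] (z<x (toℕ i))) (cong c₂ (above-y-x i))) (∑-final (c₂ ∘ suc) m h)))
    -- Read from the right end each pair starts with its y, so the two kinds of steps have exchanged
    -- their prices.
    (trans (+-comm (partial c₂ (m ∸ h)) (partial (c₂ ∘ suc) (m ∸ h)))
           (trans (partial-c₂ (m ∸ h)) (cong squares m∸h≡h′)))

  defect-balanced : defect layout + 2 * balance m ≡ squares m
  defect-balanced = trans
    (cong (_+ 2 * balance m)
      (cong₂ _+_ (cong₂ _+_ sumBelow-squares sumAbove-squares)
        (cong₂ _+_ (cong₂ _+_ (cong₂ (λ s t → s * c₂ t) below-y-z above-x-z) (cong₂ (λ s t → s * c₂ t) above-y-z below-x-z))
                   (cong₂ _+_ (cong₂ (λ s t → s * c₂ t) below-x-z above-y-z) (cong₂ (λ s t → s * c₂ t) above-x-z below-y-z)))))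
    (trans (squares-+ h h′) (cong squares h+h′≡m))

  hub : ℕ
  hub = hubCrossings layout

  hub-value : 2 * hub + squares m ≡ 2 * (m * c₂ m) + 2 * balance m
  hub-value = begin
    2 * hub + squares m                           ≡⟨ cong (2 * hub +_) defect-balanced ⟨
    2 * hub + (defect layout + 2 * balance m)     ≡⟨ +-assoc (2 * hub) (defect layout) (2 * balance m) ⟨
    2 * hub + defect layout + 2 * balance m       ≡⟨ cong (_+ 2 * balance m) (hub-identity layout) ⟩
    2 * (m * c₂ m) + 2 * balance m                ∎
    where open ≡-Reasoning

  hub-max : (ℓ : Layout m) → hubCrossings ℓ ≤ hub
  hub-max ℓ = *-cancelˡ-≤ 2 (+-cancelʳ-≤ (squares m) _ _ (≤-trans (hubCrossings-≤ ℓ) (≤-reflexive (sym hub-value))))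

  -- Pairs x y | x′ y′ in the balanced ordering

  bipartite : ℕ
  bipartite = ∑[ k < m ] ∑[ l < m ] crossings (ky k) (ky l) kx

  private
    -- The failures in `crossings-<` for `ky k` before `ky l`: below the first lie `suc (toℕ k)`
    -- x's, above the second `m ∸ suc (toℕ l)`.
    V : Fin m → Fin m → ℕ
    V k l = [ toℕ k <ᵇ toℕ l ] * c₂ (suc (toℕ k)) + [ toℕ k <ᵇ toℕ l ] * c₂ (m ∸ suc (toℕ l))

    -- Each half of `V` has a `c₂` factor in one index only. Summing over that index first yields
    -- partial sums of `c₂ ∘ suc` and of `c₂`, which `partial-c₂` joins.
    ∑∑V : ∑[ k < m ] ∑[ l < m ] V k l ≡ partial squares m
    ∑∑V = begin
      ∑[ k < m ] ∑[ l < m ] V k l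
        ≡⟨ ∑∑-distrib-+ {m} {m} (λ k l → [ toℕ k <ᵇ toℕ l ] * c₂ (suc (toℕ k))) (λ k l → [ toℕ k <ᵇ toℕ l ] * c₂ (m ∸ suc (toℕ l))) ⟩
      (∑[ k < m ] ∑[ l < m ] ([ toℕ k <ᵇ toℕ l ] * c₂ (suc (toℕ k)))) + (∑[ k < m ] ∑[ l < m ] ([ toℕ k <ᵇ toℕ l ] * c₂ (m ∸ suc (toℕ l))))
        ≡⟨ cong₂ _+_
             (trans (∑-comm {m} {m} (λ k l → [ toℕ k <ᵇ toℕ l ] * c₂ (suc (toℕ k))))
             (trans (sum-cong-≗ {m} λ l → ∑-initial (c₂ ∘ suc) {m} (<⇒≤ (toℕ<n l))) (∑-partial (partial (c₂ ∘ suc)) m)))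
             (trans (sum-cong-≗ {m} λ k → trans (∑-final c₂ m (suc (toℕ k))) (sym (*-identityˡ _))) (∑-final (partial c₂) m 0)) ⟩
      partial (partial (c₂ ∘ suc)) m + partial (partial c₂) m
        ≡⟨ partial-+ (partial (c₂ ∘ suc)) (partial c₂) m ⟩
      partial (λ i → partial (c₂ ∘ suc) i + partial c₂ i) m
        ≡⟨ partial-cong partial-c₂ m ⟩
      partial squares m ∎
      where open ≡-Reasoning

    open Layout layout using (x-inj; x≢y)

    crossings-ordered : ∀ k l → toℕ k < toℕ l → 2 * crossings (ky k) (ky l) kx + (c₂ (suc (toℕ k)) + c₂ (m ∸ suc (toℕ l))) ≡ c₂ m
    crossings-ordered k l k<l = trans
      (cong₂ (λ s t → 2 * crossings (ky k) (ky l) kx + (c₂ s + c₂ t)) (sym (below-x-y k)) (sym (above-x-y l)))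
      (crossings-< x-inj (λ i → x≢y i k) (λ i → x≢y i l) (m<n⇒m<1+n (slot-< k<l)))

    pointwise : ∀ k l → 2 * crossings (ky k) (ky l) kx + (V k l + V l k) + δ k l * c₂ m ≡ c₂ m
    pointwise k l with <-cmp (toℕ k) (toℕ l)
    ... | tri< k<l k≢l _ = trans
      (lem (crossings (ky k) (ky l) kx) (c₂ (suc (toℕ k))) (c₂ (m ∸ suc (toℕ l))) (c₂ (suc (toℕ l))) (c₂ (m ∸ suc (toℕ k)))
           ([<]-true k<l) ([<]-false (<⇒≤ k<l)) (δ-≢ (k≢l ∘ cong toℕ)))
      (crossings-ordered k l k<l)
      where
      lem : ∀ q a b c d {s t e f} → s ≡ 1 → t ≡ 0 → e ≡ 0 → 2 * q + (s * a + s * b + (t * c + t * d)) + e * f ≡ 2 * q + (a + b)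
      lem q a b c d refl refl refl = ring q a b where
        ring : ∀ q a b → 2 * q + (a + 0 + (b + 0) + 0) + 0 ≡ 2 * q + (a + b)
        ring = solve-∀
    ... | tri≈ _ k≡l _ with toℕ-injective k≡l
    ...   | refl = lem (crossings-self (ky k) kx) ([<]-false (≤-refl {toℕ k})) (δ-refl k)
      where
      lem : ∀ {q a b c d s e f} → q ≡ 0 → s ≡ 0 → e ≡ 1 → 2 * q + (s * a + s * b + (s * c + s * d)) + e * f ≡ f
      lem {f = f} refl refl refl = *-identityˡ f
    pointwise k l | tri> _ k≢l l<k = trans
      (lem (crossings (ky k) (ky l) kx) (c₂ (suc (toℕ k))) (c₂ (m ∸ suc (toℕ l))) (c₂ (suc (toℕ l))) (c₂ (m ∸ suc (toℕ k)))
           ([<]-false (<⇒≤ l<k)) ([<]-true l<k) (δ-≢ (k≢l ∘ cong toℕ)))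
      (trans (cong (λ q → 2 * q + (c₂ (suc (toℕ l)) + c₂ (m ∸ suc (toℕ k)))) (crossings-swap (ky k) (ky l) kx))
             (crossings-ordered l k l<k))
      where
      lem : ∀ q a b c d {s t e f} → s ≡ 0 → t ≡ 1 → e ≡ 0 → 2 * q + (s * a + s * b + (t * c + t * d)) + e * f ≡ 2 * q + (c + d)
      lem q a b c d refl refl refl = ring q c d where
        ring : ∀ q a b → 2 * q + (a + 0 + (b + 0)) + 0 ≡ 2 * q + (a + b)
        ring = solve-∀

  -- Each of the `m * m` ordered pairs of y's accounts for `c₂ m`. The diagonal has no crossings;
  -- its share `m * c₂ m`, supplied by `δ`, is cancelled at the end.
  bipartite-value : 2 * bipartite + 2 * partial squares m ≡ c₂ m * c₂ m
  bipartite-value = +-cancelʳ-≡ (m * c₂ m) _ _ (begin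
    2 * bipartite + 2 * partial squares m + m * c₂ m
      ≡⟨ cong (λ v → 2 * bipartite + v + m * c₂ m) (trans (cong (W +_) (+-identityʳ W)) (cong₂ _+_ (sym ∑∑V) (sym (trans (∑-comm (λ k l → V l k)) ∑∑V)))) ⟩
    2 * bipartite + (∑∑ V + ∑∑ (λ k l → V l k)) + m * c₂ m
      ≡⟨ cong₂ (λ s t → s + t + m * c₂ m) 2*bip (∑∑-distrib-+ V (λ k l → V l k)) ⟨
    ∑∑ (λ k l → 2 * C k l) + ∑∑ (λ k l → V k l + V l k) + m * c₂ m
      ≡⟨ cong₂ _+_ (∑∑-distrib-+ (λ k l → 2 * C k l) (λ k l → V k l + V l k)) (trans (∑∑-diagonal {m} (λ _ → c₂ m)) (∑-const m (c₂ m))) ⟨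
    ∑∑ (λ k l → 2 * C k l + (V k l + V l k)) + ∑∑ (λ k l → δ k l * c₂ m)
      ≡⟨ ∑∑-distrib-+ (λ k l → 2 * C k l + (V k l + V l k)) (λ k l → δ k l * c₂ m) ⟨
    ∑∑ (λ k l → 2 * C k l + (V k l + V l k) + δ k l * c₂ m)
      ≡⟨ sum-cong-≗ (λ k → sum-cong-≗ (pointwise k)) ⟩
    ∑∑ (λ _ _ → c₂ m)
      ≡⟨ trans (∑-const m (∑[ l < m ] c₂ m)) (cong (m *_) (∑-const m (c₂ m))) ⟩
    m * (m * c₂ m)
      ≡⟨ trans (sym (*-assoc m m (c₂ m))) (cong (_* c₂ m) (sym (c₂-square m))) ⟩
    (c₂ m + m) * c₂ m
      ≡⟨ *-distribʳ-+ (c₂ m) (c₂ m) m ⟩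
    c₂ m * c₂ m + m * c₂ m ∎)
    where
    open ≡-Reasoning
    W = partial squares m
    ∑∑ : (Fin m → Fin m → ℕ) → ℕ
    ∑∑ f = ∑[ i < m ] ∑[ j < m ] f i j
    C : Fin m → Fin m → ℕ
    C k l = crossings (ky k) (ky l) kx
    2*bip : ∑∑ (λ k l → 2 * C k l) ≡ 2 * bipartite
    2*bip = trans (sum-cong-≗ λ k → sym (*-distribˡ-sum 2 (C k))) (sym (*-distribˡ-sum 2 (λ k → sum (C k))))

-- Sums over all permutations

total : ∀ {A : Set} → (A → ℕ) → List A → ℕ
total f []      = 0
total f (a ∷ L) = f a + total f L

total-cong : ∀ {A : Set} {f g : A → ℕ} → (∀ a → f a ≡ g a) → ∀ L → total f L ≡ total g L
total-cong f≡g []      = refl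
total-cong f≡g (a ∷ L) = cong₂ _+_ (f≡g a) (total-cong f≡g L)

total-const : ∀ {A : Set} c (L : List A) → total (λ _ → c) L ≡ length L * c
total-const c []      = refl
total-const c (a ∷ L) = cong (c +_) (total-const c L)

total-++ : ∀ {A : Set} (f : A → ℕ) L M → total f (L ++ M) ≡ total f L + total f M
total-++ f []      M = refl
total-++ f (a ∷ L) M = trans (cong (f a +_) (total-++ f L M)) (sym (+-assoc (f a) (total f L) (total f M)))

total-map : ∀ {A B : Set} (f : B → ℕ) (h : A → B) L → total f (map h L) ≡ total (f ∘ h) L
total-map f h []      = refl
total-map f h (a ∷ L) = cong (f (h a) +_) (total-map f h L)

total-concatMap : ∀ {A B : Set} (f : B → ℕ) (h : A → List B) L → total f (concatMap h L) ≡ total (total f ∘ h) L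
total-concatMap f h []      = refl
total-concatMap f h (a ∷ L) = trans (total-++ f (h a) (concatMap h L)) (cong (total f (h a) +_) (total-concatMap f h L))

total-tabulate : ∀ {A : Set} (f : A → ℕ) {n} (g : Fin n → List A) → total f (concat (tabulate g)) ≡ ∑[ j < n ] total f (g j)
total-tabulate f {zero}  g = refl
total-tabulate f {suc n} g = trans (total-++ f (g zero) (concat (tabulate (g ∘ suc))))
                                   (cong (total f (g zero) +_) (total-tabulate f (g ∘ suc)))

total-+ : ∀ {A : Set} (f g : A → ℕ) L → total (λ a → f a + g a) L ≡ total f L + total g L
total-+ f g []      = refl
total-+ f g (a ∷ L) = trans (cong (f a + g a +_) (total-+ f g L)) (lem (f a) (g a) (total f L) (total g L))
  where
  lem : ∀ a b c d → a + b + (c + d) ≡ a + c + (b + d)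
  lem = solve-∀

length-total : ∀ {A : Set} (L : List A) → length L ≡ total (λ _ → 1) L
length-total L = sym (trans (total-const 1 L) (*-identityʳ (length L)))

abstract
  permutations : ∀ n → List (Permutation′ n)
  permutations zero    = idₚ ∷ []
  permutations (suc n) = concat (tabulate λ j → map (insert zero j) (permutations n))

  total-permutations : ∀ {n} (f : Permutation′ (suc n) → ℕ) →
    total f (permutations (suc n)) ≡ ∑[ j < suc n ] total (λ π → f (insert zero j π)) (permutations n)
  total-permutations {n} f = trans (total-tabulate f (λ j → map (insert zero j) (permutations n)))
    (sum-cong-≗ {suc n} λ j → total-map f (insert zero j) (permutations n))

  -- Completeness is pointwise because a permutation also carries its inverse and proofs; only its
  -- values matter for separation.
  permutations-complete : ∀ {n} (σ : Permutation′ n) → Any (λ π → ∀ i → π ⟨$⟩ʳ i ≡ σ ⟨$⟩ʳ i) (permutations n)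
  permutations-complete {zero}  σ = here λ ()
  permutations-complete {suc n} σ = Any.concat⁺ (Any.tabulate⁺ {f = λ j → map (insert zero j) (permutations n)} (σ ⟨$⟩ʳ zero)
    (Any.map⁺ {f = insert zero (σ ⟨$⟩ʳ zero)}
      (Any.map (λ {π} → extend {π}) (permutations-complete (remove zero σ)))))
    where
    extend : ∀ {π} → (∀ i → π ⟨$⟩ʳ i ≡ remove zero σ ⟨$⟩ʳ i) → ∀ i → insert zero (σ ⟨$⟩ʳ zero) π ⟨$⟩ʳ i ≡ σ ⟨$⟩ʳ i
    extend eq zero    = refl
    extend eq (suc i) = trans (cong (punchIn (σ ⟨$⟩ʳ zero)) (eq i)) (insert-remove zero σ (suc i))

permCount : ℕ → ℕ
permCount n = length (permutations n)

permCount-suc : ∀ n → permCount (suc n) ≡ suc n * permCount n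
permCount-suc n = begin
  permCount (suc n)                                             ≡⟨ length-total (permutations (suc n)) ⟩
  total (λ _ → 1) (permutations (suc n))                        ≡⟨ total-permutations {n} (λ _ → 1) ⟩
  ∑[ j < suc n ] total (λ _ → 1) (permutations n)               ≡⟨ ∑-const (suc n) (total (λ _ → 1) (permutations n)) ⟩
  suc n * total (λ _ → 1) (permutations n)                      ≡⟨ cong (suc n *_) (length-total (permutations n)) ⟨
  suc n * permCount n                                           ∎
  where open ≡-Reasoning

-- Each value is missed for exactly one of the `suc n` choices of `j`.
∑-punchIn : ∀ {n} (g : Fin (suc n) → ℕ) → ∑[ j < suc n ] ∑[ a < n ] g (punchIn j a) ≡ n * sum g
∑-punchIn {n} g = +-cancelˡ-≡ (sum g) _ _ (begin
  sum g + ∑[ j < suc n ] ∑[ a < n ] g (punchIn j a)         ≡⟨ ∑-distrib-+ g (λ j → ∑[ a < n ] g (punchIn j a)) ⟨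
  ∑[ j < suc n ] (g j + ∑[ a < n ] g (punchIn j a))         ≡⟨ sum-cong-≗ {suc n} (λ j → sum-remove {i = j} g) ⟨
  ∑[ j < suc n ] sum g                                      ≡⟨ ∑-const (suc n) (sum g) ⟩
  sum g + n * sum g                                         ∎)
  where open ≡-Reasoning

∑-remove-zero : ∀ {n} {i : Fin (suc n)} (g : Fin (suc n) → ℕ) → g i ≡ 0 → ∑[ a < n ] g (punchIn i a) ≡ sum g
∑-remove-zero {n} {i} g gi≡0 = sym (trans (sum-remove {i = i} g) (cong (_+ ∑[ a < n ] g (punchIn i a)) gi≡0))

-- Omitting `j` deletes its row and its column, which overlap in a diagonal entry, hence in zero. So
-- an off-diagonal entry survives for `n` of the `2 + n` choices of `j`.
∑∑-punchIn : ∀ {n} (g : Fin (2 + n) → Fin (2 + n) → ℕ) → (∀ i → g i i ≡ 0) →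
  ∑[ j < 2 + n ] ∑[ a < suc n ] ∑[ b < suc n ] g (punchIn j a) (punchIn j b) ≡ n * ∑[ i < 2 + n ] sum (g i)
∑∑-punchIn {n} g diag = +-cancelˡ-≡ (G + G) _ _ (begin
  G + G + ∑[ j < N ] D j
    ≡⟨ cong₂ (λ s t → s + t + ∑[ j < N ] D j) (refl {x = G}) (∑-comm g) ⟩
  ∑[ j < N ] sum (g j) + ∑[ j < N ] (∑[ i < N ] g i j) + ∑[ j < N ] D j
    ≡⟨ cong (_+ ∑[ j < N ] D j) (∑-distrib-+ (λ j → sum (g j)) (λ j → ∑[ i < N ] g i j)) ⟨
  ∑[ j < N ] (sum (g j) + ∑[ i < N ] g i j) + ∑[ j < N ] D j
    ≡⟨ ∑-distrib-+ (λ j → sum (g j) + ∑[ i < N ] g i j) D ⟨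
  ∑[ j < N ] (sum (g j) + (∑[ i < N ] g i j) + D j)
    ≡⟨ sum-cong-≗ {N} split ⟨
  ∑[ j < N ] G
    ≡⟨ ∑-const N G ⟩
  N * G
    ≡⟨ +-assoc G G (n * G) ⟨
  G + G + n * G ∎)
  where
  open ≡-Reasoning
  N = 2 + n
  G = ∑[ i < N ] sum (g i)
  D : Fin N → ℕ
  D j = ∑[ a < suc n ] ∑[ b < suc n ] g (punchIn j a) (punchIn j b)
  split : ∀ j → G ≡ sum (g j) + (∑[ i < N ] g i j) + D j
  split j = begin
    G
      ≡⟨ sum-remove {i = j} (λ i → sum (g i)) ⟩
    sum (g j) + ∑[ a < suc n ] sum (g (punchIn j a))
      ≡⟨ cong (sum (g j) +_) (sum-cong-≗ {suc n} λ a → sum-remove {i = j} (g (punchIn j a))) ⟩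
    sum (g j) + ∑[ a < suc n ] (g (punchIn j a) j + ∑[ b < suc n ] g (punchIn j a) (punchIn j b))
      ≡⟨ cong (sum (g j) +_) (∑-distrib-+ (λ a → g (punchIn j a) j) (λ a → ∑[ b < suc n ] g (punchIn j a) (punchIn j b))) ⟩
    sum (g j) + (∑[ a < suc n ] g (punchIn j a) j + D j)
      ≡⟨ cong (λ s → sum (g j) + (s + D j)) (∑-remove-zero {i = j} (λ i → g i j) (diag j)) ⟩
    sum (g j) + (∑[ i < N ] g i j + D j)
      ≡⟨ +-assoc (sum (g j)) (∑[ i < N ] g i j) (D j) ⟨
    sum (g j) + (∑[ i < N ] g i j) + D j ∎

onePoint : ∀ {n} (g : Fin (suc n) → ℕ) i → total (λ π → g (π ⟨$⟩ʳ i)) (permutations (suc n)) ≡ permCount n * sum g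
onePoint {n} g zero = begin
  total (λ π → g (π ⟨$⟩ʳ zero)) (permutations (suc n))    ≡⟨ total-permutations {n} (λ π → g (π ⟨$⟩ʳ zero)) ⟩
  ∑[ j < suc n ] total (λ _ → g j) (permutations n)       ≡⟨ sum-cong-≗ {suc n} (λ j → total-const (g j) (permutations n)) ⟩
  ∑[ j < suc n ] (permCount n * g j)                      ≡⟨ *-distribˡ-sum (permCount n) g ⟨
  permCount n * sum g                                     ∎
  where open ≡-Reasoning
onePoint {suc n} g (suc i) = begin
  total (λ π → g (π ⟨$⟩ʳ suc i)) (permutations (2 + n))
    ≡⟨ total-permutations {suc n} (λ π → g (π ⟨$⟩ʳ suc i)) ⟩
  ∑[ j < 2 + n ] total (λ π → g (punchIn j (π ⟨$⟩ʳ i))) (permutations (suc n))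
    ≡⟨ sum-cong-≗ {2 + n} (λ j → onePoint (g ∘ punchIn j) i) ⟩
  ∑[ j < 2 + n ] (permCount n * ∑[ a < suc n ] g (punchIn j a))
    ≡⟨ *-distribˡ-sum (permCount n) (λ j → ∑[ a < suc n ] g (punchIn j a)) ⟨
  permCount n * ∑[ j < 2 + n ] ∑[ a < suc n ] g (punchIn j a)
    ≡⟨ cong (permCount n *_) (∑-punchIn g) ⟩
  permCount n * (suc n * sum g)
    ≡⟨ lem (permCount n) (suc n) (sum g) ⟩
  suc n * permCount n * sum g
    ≡⟨ cong (_* sum g) (permCount-suc n) ⟨
  permCount (suc n) * sum g ∎
  where
  open ≡-Reasoning
  lem : ∀ a b c → a * (b * c) ≡ b * a * c
  lem = solve-∀

private
  twoPoint-zero : ∀ {n} (g : Fin (2 + n) → Fin (2 + n) → ℕ) → (∀ i → g i i ≡ 0) → ∀ j →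
    total (λ π → g (π ⟨$⟩ʳ zero) (π ⟨$⟩ʳ suc j)) (permutations (2 + n)) ≡ permCount n * ∑[ i < 2 + n ] sum (g i)
  twoPoint-zero {n} g diag j = begin
    total (λ π → g (π ⟨$⟩ʳ zero) (π ⟨$⟩ʳ suc j)) (permutations (2 + n))
      ≡⟨ total-permutations {suc n} (λ π → g (π ⟨$⟩ʳ zero) (π ⟨$⟩ʳ suc j)) ⟩
    ∑[ a < 2 + n ] total (λ π → g a (punchIn a (π ⟨$⟩ʳ j))) (permutations (suc n))
      ≡⟨ sum-cong-≗ {2 + n} (λ a → trans (onePoint (g a ∘ punchIn a) j)
                                         (cong (permCount n *_) (∑-remove-zero (g a) (diag a)))) ⟩
    ∑[ a < 2 + n ] (permCount n * sum (g a))
      ≡⟨ *-distribˡ-sum (permCount n) (λ a → sum (g a)) ⟨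
    permCount n * ∑[ i < 2 + n ] sum (g i) ∎
    where open ≡-Reasoning

-- The images of `i` and `j` run uniformly through the pairs of distinct values; the zero diagonal
-- allows the right side to sum over all pairs.
twoPoint : ∀ {n} (g : Fin (2 + n) → Fin (2 + n) → ℕ) → (∀ i → g i i ≡ 0) → ∀ {i j} → i ≢ j →
  total (λ π → g (π ⟨$⟩ʳ i) (π ⟨$⟩ʳ j)) (permutations (2 + n)) ≡ permCount n * ∑[ i < 2 + n ] sum (g i)
twoPoint g diag {zero}  {zero}  i≢j = contradiction refl i≢j
twoPoint g diag {zero}  {suc j} i≢j = twoPoint-zero g diag j
twoPoint {n} g diag {suc i} {zero}  i≢j =
  trans (twoPoint-zero (λ a b → g b a) diag i) (cong (permCount n *_) (sym (∑-comm g)))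
twoPoint {zero} g diag {suc zero} {suc zero} i≢j = contradiction refl i≢j
twoPoint {suc n} g diag {suc i} {suc j} i≢j = begin
  total (λ π → g (π ⟨$⟩ʳ suc i) (π ⟨$⟩ʳ suc j)) (permutations (3 + n))
    ≡⟨ total-permutations {2 + n} (λ π → g (π ⟨$⟩ʳ suc i) (π ⟨$⟩ʳ suc j)) ⟩
  ∑[ a < 3 + n ] total (λ π → g (punchIn a (π ⟨$⟩ʳ i)) (punchIn a (π ⟨$⟩ʳ j))) (permutations (2 + n))
    ≡⟨ sum-cong-≗ {3 + n} (λ a → twoPoint (λ b c → g (punchIn a b) (punchIn a c)) (diag ∘ punchIn a) (i≢j ∘ cong suc)) ⟩
  ∑[ a < 3 + n ] (permCount n * D a)
    ≡⟨ *-distribˡ-sum (permCount n) D ⟨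
  permCount n * sum D
    ≡⟨ cong (permCount n *_) (∑∑-punchIn g diag) ⟩
  permCount n * (suc n * ∑[ i < 3 + n ] sum (g i))
    ≡⟨ lem (permCount n) (suc n) (∑[ i < 3 + n ] sum (g i)) ⟩
  suc n * permCount n * ∑[ i < 3 + n ] sum (g i)
    ≡⟨ cong (_* ∑[ i < 3 + n ] sum (g i)) (permCount-suc n) ⟨
  permCount (suc n) * ∑[ i < 3 + n ] sum (g i) ∎
  where
  open ≡-Reasoning
  D : Fin (3 + n) → ℕ
  D a = ∑[ b < 2 + n ] ∑[ c < 2 + n ] g (punchIn a b) (punchIn a c)
  lem : ∀ a b c → a * (b * c) ≡ b * a * c
  lem = solve-∀

-- Orderings and layouts

injective⇒surjective : ∀ {n} {f : Fin n → Fin n} → (∀ {i j} → f i ≡ f j → i ≡ j) → ∀ k → ∃ λ i → f i ≡ k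
injective⇒surjective {suc n} {f} inj k with any? (λ i → f i ≟ᶠ k)
... | yes found = found
... | no  none  = contradiction (injective⇒≤ {f = λ i → punchOut (k≢f i)} (λ {i} {j} e → inj (punchOut-injective (k≢f i) (k≢f j) e))) 1+n≰n
  where
  k≢f : ∀ i → k ≢ f i
  k≢f i e = none (i , sym e)

module _ {n} (key : Fin n → ℕ) (key<n : ∀ v → key v < n) (key-inj : Inj key) where

  private
    f : Fin n → Fin n
    f v = fromℕ< (key<n v)

    f-inj : ∀ {u v} → f u ≡ f v → u ≡ v
    f-inj {u} {v} e = key-inj (trans (sym (toℕ-fromℕ< (key<n u))) (trans (cong toℕ e) (toℕ-fromℕ< (key<n v))))

    f-surj : ∀ k → ∃ λ i → f i ≡ k
    f-surj = injective⇒surjective f-inj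

  keyOrder : LinOrd n
  keyOrder = permutation f (λ k → proj₁ (f-surj k)) (λ k → proj₂ (f-surj k))
                         (λ v → f-inj (proj₂ (f-surj (f v))))

  pos-keyOrder : ∀ v → pos keyOrder v ≡ key v
  pos-keyOrder v = toℕ-fromℕ< (key<n v)

module _ {m : ℕ} where

  xv yv : Fin m → Fin (1 + m + m)
  xv i = suc (i ↑ˡ m)
  yv j = suc (m ↑ʳ j)

  vertex-elim : (Q : Fin (1 + m + m) → Set) → Q zero → (∀ i → Q (xv i)) → (∀ j → Q (yv j)) → ∀ v → Q v
  vertex-elim Q qz qx qy zero = qz
  vertex-elim Q qz qx qy (suc w) with splitAt m w | join-splitAt m m w
  ... | inj₁ i | refl = qx i
  ... | inj₂ j | refl = qy j

  part-x : ∀ i → part m (xv i) ≡ 1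
  part-x i rewrite toℕ-↑ˡ i m | <ᵇ-true (toℕ<n i) = refl

  part-y : ∀ j → part m (yv j) ≡ 2
  part-y j rewrite toℕ-↑ʳ m j | <ᵇ-false (m≤m+n m (toℕ j)) = refl

  zx-adj : ∀ i → Adj m zero (xv i)
  zx-adj i e = contradiction (trans e (part-x i)) λ ()

  zy-adj : ∀ j → Adj m zero (yv j)
  zy-adj j e = contradiction (trans e (part-y j)) λ ()

  xy-adj : ∀ i j → Adj m (xv i) (yv j)
  xy-adj i j e = contradiction (trans (sym (part-x i)) (trans e (part-y j))) λ ()

  xv≢yv : ∀ i j → xv i ≢ yv j
  xv≢yv i j = xy-adj i j ∘ cong (part m)

  xv-inj : ∀ {i j} → xv i ≡ xv j → i ≡ j
  xv-inj {i} {j} e = ↑ˡ-injective m i j (suc-injectiveᶠ e)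

  yv-inj : ∀ {i j} → yv i ≡ yv j → i ≡ j
  yv-inj {i} {j} e = ↑ʳ-injective m i j (suc-injectiveᶠ e)

  edge-elim : (Q : Fin (1 + m + m) → Fin (1 + m + m) → Set) → (∀ {a b} → Q a b → Q b a) →
              (∀ i → Q zero (xv i)) → (∀ j → Q zero (yv j)) → (∀ i j → Q (xv i) (yv j)) → ∀ a b → Adj m a b → Q a b
  edge-elim Q Q-sym zx zy xy = vertex-elim _
    (vertex-elim _ (λ adj → contradiction refl adj) (λ i _ → zx i) (λ j _ → zy j))
    (λ i → vertex-elim _ (λ _ → Q-sym (zx i)) (λ k adj → contradiction (trans (part-x i) (sym (part-x k))) adj) (λ j _ → xy i j))
    (λ j → vertex-elim _ (λ _ → Q-sym (zy j)) (λ i _ → Q-sym (xy i j)) (λ k adj → contradiction (trans (part-y j) (sym (part-y k))) adj))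

  pos-inj : (σ : LinOrd (1 + m + m)) → ∀ {u v} → pos σ u ≡ pos σ v → u ≡ v
  pos-inj σ e = Injection.injective (↔⇒↣ σ) (toℕ-injective e)

  layoutOf : LinOrd (1 + m + m) → Layout m
  layoutOf σ = record
    { z = pos σ zero
    ; x = pos σ ∘ xv
    ; y = pos σ ∘ yv
    ; x-inj = xv-inj ∘ pos-inj σ
    ; y-inj = yv-inj ∘ pos-inj σ
    ; x≢y = λ i j → xv≢yv i j ∘ pos-inj σ
    ; x≢z = λ i e → contradiction (pos-inj σ e) λ ()
    ; y≢z = λ i e → contradiction (pos-inj σ e) λ ()
    ; bound = m + m
    ; x≤bound = λ i → ≤-pred (toℕ<n (σ ⟨$⟩ʳ xv i))
    ; y≤bound = λ i → ≤-pred (toℕ<n (σ ⟨$⟩ʳ yv i))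
    ; z≤bound = ≤-pred (toℕ<n (σ ⟨$⟩ʳ zero))
    }

  module _ (ℓ : Layout m) (fits : Layout.bound ℓ ≤ m + m) where
    open Layout ℓ

    private
      key : Fin (1 + m + m) → ℕ
      key zero    = z
      key (suc w) = [ x , y ]′ (splitAt m w)

      key-x : ∀ i → key (xv i) ≡ x i
      key-x i = cong [ x , y ]′ (splitAt-↑ˡ m i m)

      key-y : ∀ j → key (yv j) ≡ y j
      key-y j = cong [ x , y ]′ (splitAt-↑ʳ m m j)

      key< : ∀ v → key v < 1 + m + m
      key< = vertex-elim _ (s≤s (≤-trans z≤bound fits))
        (λ i → s≤s (≤-trans (≤-reflexive (key-x i)) (≤-trans (x≤bound i) fits)))
        (λ j → s≤s (≤-trans (≤-reflexive (key-y j)) (≤-trans (y≤bound j) fits)))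

      key-inj : ∀ u v → key u ≡ key v → u ≡ v
      key-inj = vertex-elim _
        (vertex-elim _ (λ _ → refl)
          (λ i e → contradiction (sym (trans e (key-x i))) (x≢z i))
          (λ j e → contradiction (sym (trans e (key-y j))) (y≢z j)))
        (λ i → vertex-elim _
          (λ e → contradiction (trans (sym (key-x i)) e) (x≢z i))
          (λ k e → cong xv (x-inj (trans (sym (key-x i)) (trans e (key-x k)))))
          (λ j e → contradiction (trans (sym (key-x i)) (trans e (key-y j))) (x≢y i j)))
        (λ j → vertex-elim _
          (λ e → contradiction (trans (sym (key-y j)) e) (y≢z j))
          (λ i e → contradiction (trans (sym (key-x i)) (trans (sym e) (key-y j))) (x≢y i j))
          (λ k e → cong yv (y-inj (trans (sym (key-y j)) (trans e (key-y k))))))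

    abstract
      order : LinOrd (1 + m + m)
      order = keyOrder key key< (λ {u} {v} → key-inj u v)

      pos-z : pos order zero ≡ z
      pos-z = pos-keyOrder key key< (λ {u} {v} → key-inj u v) zero

      pos-x : ∀ i → pos order (xv i) ≡ x i
      pos-x i = trans (pos-keyOrder key key< (λ {u} {v} → key-inj u v) (xv i)) (key-x i)

      pos-y : ∀ j → pos order (yv j) ≡ y j
      pos-y j = trans (pos-keyOrder key key< (λ {u} {v} → key-inj u v) (yv j)) (key-y j)

  swapParts : Layout m → Layout m
  swapParts ℓ = record
    { z = z ; x = y ; y = x ; x-inj = y-inj ; y-inj = x-inj
    ; x≢y = λ i j e → x≢y j i (sym e) ; x≢z = y≢z ; y≢z = x≢z
    ; bound = bound ; x≤bound = y≤bound ; y≤bound = x≤bound ; z≤bound = z≤bound }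
    where open Layout ℓ

  relabel : Permutation′ m → Permutation′ m → Layout m → Layout m
  relabel σ τ ℓ = record
    { z = z ; x = x ∘ (σ ⟨$⟩ʳ_) ; y = y ∘ (τ ⟨$⟩ʳ_)
    ; x-inj = Injection.injective (↔⇒↣ σ) ∘ x-inj ; y-inj = Injection.injective (↔⇒↣ τ) ∘ y-inj
    ; x≢y = λ i j → x≢y (σ ⟨$⟩ʳ i) (τ ⟨$⟩ʳ j) ; x≢z = x≢z ∘ (σ ⟨$⟩ʳ_) ; y≢z = y≢z ∘ (τ ⟨$⟩ʳ_)
    ; bound = bound ; x≤bound = x≤bound ∘ (σ ⟨$⟩ʳ_) ; y≤bound = y≤bound ∘ (τ ⟨$⟩ʳ_) ; z≤bound = z≤bound }
    where open Layout ℓ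

-- Double counting over a separating list

sep-cong : ∀ {a a′ b b′ c c′ d d′} → a ≡ a′ → b ≡ b′ → c ≡ c′ → d ≡ d′ → [ sep a b c d ] ≡ [ sep a′ b′ c′ d′ ]
sep-cong refl refl refl refl = refl

countSep-total : ∀ {n} (L : List (LinOrd n)) a b c d → countSep L a b c d ≡ total (λ σ → [ separates σ a b c d ]) L
countSep-total []      a b c d = refl
countSep-total (σ ∷ L) a b c d = cong ([ separates σ a b c d ] +_) (countSep-total L a b c d)

∑-total : ∀ {A : Set} {n} (f : Fin n → A → ℕ) L → ∑[ j < n ] total (f j) L ≡ total (λ a → ∑[ j < n ] f j a) L
∑-total {n = n} f []      = ∑-zero {n} λ _ → refl
∑-total {n = n} f (a ∷ L) = trans (∑-distrib-+ (λ j → f j a) (λ j → total (f j) L)) (cong (∑[ j < n ] f j a +_) (∑-total f L))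

∑∑∑-total : ∀ {A : Set} {n} (f : Fin n → Fin n → Fin n → A → ℕ) L →
  ∑[ i < n ] ∑[ j < n ] ∑[ k < n ] total (f i j k) L ≡ total (λ a → ∑[ i < n ] ∑[ j < n ] ∑[ k < n ] f i j k a) L
∑∑∑-total {n = n} f L = trans
  (sum-cong-≗ {n} λ i → trans (sum-cong-≗ {n} λ j → ∑-total (f i j) L) (∑-total (λ j a → ∑[ k < n ] f i j k a) L))
  (∑-total (λ i a → ∑[ j < n ] ∑[ k < n ] f i j k a) L)

total-mono : ∀ {A : Set} {f : A → ℕ} {c} → (∀ a → f a ≤ c) → ∀ L → total f L ≤ length L * c
total-mono f≤c []      = z≤n
total-mono f≤c (a ∷ L) = +-mono-≤ (f≤c a) (total-mono f≤c L)

∑∑-offDiagonal : ∀ {n t} {F : Fin n → Fin n → ℕ} → (∀ {i j} → i ≢ j → t ≤ F i j) → c₂ n * t ≤ ∑[ i < n ] ∑[ j < n ] F i j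
∑∑-offDiagonal {n} {t} {F} t≤F = +-cancelʳ-≤ (n * t) _ _ (begin
  c₂ n * t + n * t                                                      ≡⟨ *-distribʳ-+ t (c₂ n) n ⟨
  (c₂ n + n) * t                                                        ≡⟨ cong (_* t) (c₂-square n) ⟩
  n * n * t                                                             ≡⟨ *-assoc n n t ⟩
  n * (n * t)                                                           ≡⟨ trans (∑-const n (∑[ j < n ] t)) (cong (n *_) (∑-const n t)) ⟨
  ∑[ i < n ] ∑[ j < n ] t                                               ≤⟨ ∑-mono (λ i → ∑-mono (pointwise i)) ⟩
  ∑[ i < n ] ∑[ j < n ] (F i j + δ i j * t)                             ≡⟨ ∑∑-distrib-+ F (λ i j → δ i j * t) ⟩
  ∑[ i < n ] ∑[ j < n ] F i j + ∑[ i < n ] ∑[ j < n ] (δ i j * t)       ≡⟨ cong (∑[ i < n ] ∑[ j < n ] F i j +_) (trans (∑∑-diagonal {n} (λ _ → t)) (∑-const n t)) ⟩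
  ∑[ i < n ] ∑[ j < n ] F i j + n * t                                   ∎)
  where
  open ≤-Reasoning
  pointwise : ∀ i j → t ≤ F i j + δ i j * t
  pointwise i j with i ≟ᶠ j
  ... | yes _  = ≤-trans (≤-reflexive (sym (+-identityʳ t))) (m≤n+m (t + 0) (F i j))
  ... | no i≢j = ≤-trans (t≤F i≢j) (m≤m+n (F i j) 0)

-- Each part offers `m` single vertices, with `c₂ m` ordered pairs from the other part, and every
-- resulting pair at `z` demands `t` separations. One ordering supplies at most `hub` of them.
separating-length : ∀ {m t} (L : List (LinOrd (1 + m + m))) → TSeparating m t L →
                    2 * (m * c₂ m) * t ≤ length L * Balanced.hub m
separating-length {m} {t} L sepL = begin
  2 * (m * c₂ m) * t
    ≡⟨ lem m (c₂ m) t ⟩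
  m * (c₂ m * t) + m * (c₂ m * t)
    ≡⟨ cong₂ _+_ (∑-const m (c₂ m * t)) (∑-const m (c₂ m * t)) ⟨
  ∑[ j < m ] (c₂ m * t) + ∑[ j < m ] (c₂ m * t)
    ≤⟨ +-mono-≤
         (∑-mono λ j → ∑∑-offDiagonal {m} λ {i} {k} i≢k → ≤-trans
            (sepL zero (xv i) (yv j) (xv k) (zx-adj i , (xy-adj k j ∘ sym) , (λ ()) , (λ ()) , xv≢yv i j , i≢k ∘ xv-inj))
            (≤-reflexive (countSep-total L zero (xv i) (yv j) (xv k))))
         (∑-mono λ j → ∑∑-offDiagonal {m} λ {i} {k} i≢k → ≤-trans
            (sepL zero (yv i) (xv j) (yv k) (zy-adj i , xy-adj j k , (λ ()) , (λ ()) , (xv≢yv j i ∘ sym) , i≢k ∘ yv-inj))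
            (≤-reflexive (countSep-total L zero (yv i) (xv j) (yv k)))) ⟩
  ∑[ j < m ] ∑[ i < m ] ∑[ k < m ] total (f j i k) L + ∑[ j < m ] ∑[ i < m ] ∑[ k < m ] total (g j i k) L
    ≡⟨ cong₂ _+_ (∑∑∑-total f L) (∑∑∑-total g L) ⟩
  total (λ σ → ∑[ j < m ] ∑[ i < m ] ∑[ k < m ] f j i k σ) L + total (λ σ → ∑[ j < m ] ∑[ i < m ] ∑[ k < m ] g j i k σ) L
    ≡⟨ total-+ (λ σ → ∑[ j < m ] ∑[ i < m ] ∑[ k < m ] f j i k σ) (λ σ → ∑[ j < m ] ∑[ i < m ] ∑[ k < m ] g j i k σ) L ⟨
  total (hubCrossings ∘ layoutOf {m}) L
    ≤⟨ total-mono (Balanced.hub-max m ∘ layoutOf {m}) L ⟩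
  length L * Balanced.hub m ∎
  where
  open ≤-Reasoning
  f g : Fin m → Fin m → Fin m → LinOrd (1 + m + m) → ℕ
  f j i k σ = [ separates σ zero (xv i) (yv j) (xv k) ]
  g j i k σ = [ separates σ zero (yv i) (xv j) (yv k) ]
  lem : ∀ m c t → 2 * (m * c) * t ≡ m * (c * t) + m * (c * t)
  lem = solve-∀

-- The symmetrised family

total-comm : ∀ {A B : Set} (f : A → B → ℕ) L M → total (λ a → total (f a) M) L ≡ total (λ b → total (λ a → f a b) L) M
total-comm f []      M = sym (trans (total-const 0 M) (*-zeroʳ (length M)))
total-comm f (a ∷ L) M = trans (cong (total (f a) M +_) (total-comm f L M)) (sym (total-+ (f a) (λ b → total (λ a → f a b) L) M))

∑∑-*ˡ : ∀ {n} c (f : Fin n → Fin n → ℕ) → ∑[ i < n ] ∑[ j < n ] (c * f i j) ≡ c * ∑[ i < n ] ∑[ j < n ] f i j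
∑∑-*ˡ {n} c f = trans (sum-cong-≗ {n} λ i → sym (*-distribˡ-sum c (f i))) (sym (*-distribˡ-sum c (λ i → sum (f i))))

module Family (n : ℕ) where
  m : ℕ
  m = 2 + n

  open Balanced m

  P : List (Permutation′ m)
  P = permutations m

  -- The second ordering exchanges the parts. The two sums in `hub` may differ (8 and 7 for
  -- `m = 3`), and only the exchange makes z x | y x′ and z y | x y′ equally frequent.
  order₁ order₂ : Permutation′ m → Permutation′ m → LinOrd (1 + m + m)
  order₁ σ τ = order (relabel σ τ layout) ≤-refl
  order₂ σ τ = order (relabel σ τ (swapParts layout)) ≤-refl

  family : List (LinOrd (1 + m + m))
  family = concatMap (λ σ → concatMap (λ τ → order₁ σ τ ∷ order₂ σ τ ∷ []) P) P

  total-family : ∀ f → total f family ≡ total (λ σ → total (λ τ → f (order₁ σ τ) + f (order₂ σ τ)) P) P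
  total-family f = trans (total-concatMap f (λ σ → concatMap (λ τ → order₁ σ τ ∷ order₂ σ τ ∷ []) P) P)
    (total-cong (λ σ → trans (total-concatMap f (λ τ → order₁ σ τ ∷ order₂ σ τ ∷ []) P)
      (total-cong (λ τ → cong (f (order₁ σ τ) +_) (+-identityʳ (f (order₂ σ τ)))) P)) P)

  length-family : length family ≡ 2 * (permCount m * permCount m)
  length-family = begin
    length family                              ≡⟨ length-total family ⟩
    total (λ _ → 1) family                     ≡⟨ total-family (λ _ → 1) ⟩
    total (λ _ → total (λ _ → 2) P) P          ≡⟨ total-const (total (λ _ → 2) P) P ⟩
    permCount m * total (λ _ → 2) P            ≡⟨ cong (permCount m *_) (total-const 2 P) ⟩
    permCount m * (permCount m * 2)            ≡⟨ lem (permCount m) ⟩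
    2 * (permCount m * permCount m)            ∎
    where
    open ≡-Reasoning
    lem : ∀ a → a * (a * 2) ≡ 2 * (a * a)
    lem = solve-∀

  -- A pair at `z` involves two values of one permutation and one value of the other: `twoPoint`
  -- gives the first factor, `onePoint` the second.
  multiplicity : ℕ
  multiplicity = permCount n * permCount (suc n) * hub

  private
    S : Fin m → Fin m → Fin m → ℕ
    S p q r = [ sep kz (kx p) (ky r) (kx q) ] + [ sep kz (ky p) (kx r) (ky q) ]

    S-diagonal : ∀ p r → S p p r ≡ 0
    S-diagonal p r = cong₂ _+_ (cong [_] (sep-incidentʳ kz (kx p) (ky r))) (cong [_] (sep-incidentʳ kz (ky p) (kx r)))

    ∑∑∑S : ∑[ p < m ] ∑[ q < m ] ∑[ r < m ] S p q r ≡ hub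
    ∑∑∑S = begin
      ∑[ p < m ] ∑[ q < m ] ∑[ r < m ] S p q r
        ≡⟨ sum-cong-≗ {m} (λ p → ∑-comm (S p)) ⟩
      ∑[ p < m ] ∑[ r < m ] ∑[ q < m ] S p q r
        ≡⟨ ∑-comm (λ p r → ∑[ q < m ] S p q r) ⟩
      ∑[ r < m ] ∑[ p < m ] ∑[ q < m ] S p q r
        ≡⟨ sum-cong-≗ {m} (λ r → ∑∑-distrib-+ (λ p q → [ sep kz (kx p) (ky r) (kx q) ]) (λ p q → [ sep kz (ky p) (kx r) (ky q) ])) ⟩
      ∑[ r < m ] (crossings kz (ky r) kx + crossings kz (kx r) ky)
        ≡⟨ ∑-distrib-+ (λ r → crossings kz (ky r) kx) (λ r → crossings kz (kx r) ky) ⟩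
      hub ∎
      where open ≡-Reasoning

    total-S : ∀ {i k} j → i ≢ k → total (λ σ → total (λ τ → S (σ ⟨$⟩ʳ i) (σ ⟨$⟩ʳ k) (τ ⟨$⟩ʳ j)) P) P ≡ multiplicity
    total-S {i} {k} j i≢k = begin
      total (λ σ → total (λ τ → S (σ ⟨$⟩ʳ i) (σ ⟨$⟩ʳ k) (τ ⟨$⟩ʳ j)) P) P
        ≡⟨ total-cong (λ σ → onePoint (S (σ ⟨$⟩ʳ i) (σ ⟨$⟩ʳ k)) j) P ⟩
      total (λ σ → permCount (suc n) * sum (S (σ ⟨$⟩ʳ i) (σ ⟨$⟩ʳ k))) P
        ≡⟨ twoPoint (λ p q → permCount (suc n) * sum (S p q))
             (λ p → trans (cong (permCount (suc n) *_) (∑-zero (S-diagonal p))) (*-zeroʳ (permCount (suc n)))) i≢k ⟩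
      permCount n * ∑[ p < m ] ∑[ q < m ] (permCount (suc n) * sum (S p q))
        ≡⟨ cong (permCount n *_) (trans (∑∑-*ˡ (permCount (suc n)) (λ p q → sum (S p q))) (cong (permCount (suc n) *_) ∑∑∑S)) ⟩
      permCount n * (permCount (suc n) * hub)
        ≡⟨ *-assoc (permCount n) (permCount (suc n)) hub ⟨
      multiplicity ∎
      where open ≡-Reasoning

    R R′ : Fin m → Fin m → Fin m → Fin m → ℕ
    R  p q r s = [ sep (kx p) (ky r) (kx q) (ky s) ]
    R′ p q r s = [ sep (ky p) (kx r) (ky q) (kx s) ]

    ∑∑∑∑R : ∑[ p < m ] ∑[ q < m ] ∑[ r < m ] ∑[ s < m ] R p q r s ≡ bipartite
    ∑∑∑∑R = begin
      ∑[ p < m ] ∑[ q < m ] ∑[ r < m ] ∑[ s < m ] R p q r s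
        ≡⟨ sum-cong-≗ {m} (λ p → ∑-comm (λ q r → ∑[ s < m ] R p q r s)) ⟩
      ∑[ p < m ] ∑[ r < m ] ∑[ q < m ] ∑[ s < m ] R p q r s
        ≡⟨ ∑-comm (λ p r → ∑[ q < m ] ∑[ s < m ] R p q r s) ⟩
      ∑[ r < m ] ∑[ p < m ] ∑[ q < m ] ∑[ s < m ] R p q r s
        ≡⟨ sum-cong-≗ {m} (λ r → sum-cong-≗ {m} (λ p → ∑-comm (λ q s → R p q r s))) ⟩
      ∑[ r < m ] ∑[ p < m ] ∑[ s < m ] ∑[ q < m ] R p q r s
        ≡⟨ sum-cong-≗ {m} (λ r → ∑-comm (λ p s → ∑[ q < m ] R p q r s)) ⟩
      ∑[ r < m ] ∑[ s < m ] ∑[ p < m ] ∑[ q < m ] R p q r s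
        ≡⟨ sum-cong-≗ {m} (λ r → sum-cong-≗ {m} (λ s → sum-cong-≗ {m} (λ p → sum-cong-≗ {m} (λ q →
             cong [_] (sep-flips (kx p) (ky r) (kx q) (ky s)))))) ⟩
      bipartite ∎
      where open ≡-Reasoning

    total-R : ∀ {i j k l} → i ≢ j → k ≢ l →
      total (λ σ → total (λ τ → R (σ ⟨$⟩ʳ i) (σ ⟨$⟩ʳ j) (τ ⟨$⟩ʳ k) (τ ⟨$⟩ʳ l) + R′ (σ ⟨$⟩ʳ i) (σ ⟨$⟩ʳ j) (τ ⟨$⟩ʳ k) (τ ⟨$⟩ʳ l)) P) P
      ≡ permCount n * (permCount n * (2 * bipartite))
    total-R {i} {j} {k} {l} i≢j k≢l = begin
      total (λ σ → total (λ τ → Q (σ ⟨$⟩ʳ i) (σ ⟨$⟩ʳ j) (τ ⟨$⟩ʳ k) (τ ⟨$⟩ʳ l)) P) P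
        ≡⟨ total-cong (λ σ → twoPoint (Q (σ ⟨$⟩ʳ i) (σ ⟨$⟩ʳ j)) (Q-diagonalʳ (σ ⟨$⟩ʳ i) (σ ⟨$⟩ʳ j)) k≢l) P ⟩
      total (λ σ → permCount n * ∑∑Q (σ ⟨$⟩ʳ i) (σ ⟨$⟩ʳ j)) P
        ≡⟨ twoPoint (λ p q → permCount n * ∑∑Q p q)
             (λ p → trans (cong (permCount n *_) (∑-zero {m} λ r → ∑-zero {m} λ s → Q-diagonalˡ p r s)) (*-zeroʳ (permCount n))) i≢j ⟩
      permCount n * ∑[ p < m ] ∑[ q < m ] (permCount n * ∑∑Q p q)
        ≡⟨ cong (permCount n *_) (∑∑-*ˡ (permCount n) ∑∑Q) ⟩
      permCount n * (permCount n * ∑[ p < m ] ∑[ q < m ] ∑∑Q p q)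
        ≡⟨ cong (λ v → permCount n * (permCount n * v)) ∑∑∑∑Q ⟩
      permCount n * (permCount n * (2 * bipartite)) ∎
      where
      open ≡-Reasoning
      Q : Fin m → Fin m → Fin m → Fin m → ℕ
      Q p q r s = R p q r s + R′ p q r s
      ∑∑Q : Fin m → Fin m → ℕ
      ∑∑Q p q = ∑[ r < m ] ∑[ s < m ] Q p q r s
      Q-diagonalˡ : ∀ p r s → Q p p r s ≡ 0
      Q-diagonalˡ p r s = cong₂ _+_ (cong [_] (sep-incidentˡ (kx p) (ky r) (ky s))) (cong [_] (sep-incidentˡ (ky p) (kx r) (kx s)))
      Q-diagonalʳ : ∀ p q r → Q p q r r ≡ 0
      Q-diagonalʳ p q r = cong₂ _+_ (cong [_] (sep-incidentʳ (kx p) (ky r) (kx q))) (cong [_] (sep-incidentʳ (ky p) (kx r) (ky q)))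
      ∑∑∑∑Q : ∑[ p < m ] ∑[ q < m ] ∑∑Q p q ≡ 2 * bipartite
      ∑∑∑∑Q = begin
        ∑[ p < m ] ∑[ q < m ] ∑∑Q p q
          ≡⟨ sum-cong-≗ {m} (λ p → sum-cong-≗ {m} (λ q → ∑∑-distrib-+ (R p q) (R′ p q))) ⟩
        ∑[ p < m ] ∑[ q < m ] (∑[ r < m ] ∑[ s < m ] R p q r s + ∑[ r < m ] ∑[ s < m ] R′ p q r s)
          ≡⟨ ∑∑-distrib-+ (λ p q → ∑[ r < m ] ∑[ s < m ] R p q r s) (λ p q → ∑[ r < m ] ∑[ s < m ] R′ p q r s) ⟩
        -- The sum of `R′` is `bipartite` by definition; that of `R` still needs reordering.
        ∑[ p < m ] ∑[ q < m ] (∑[ r < m ] ∑[ s < m ] R p q r s) + bipartite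
          ≡⟨ cong (_+ bipartite) ∑∑∑∑R ⟩
        bipartite + bipartite
          ≡⟨ cong (bipartite +_) (+-identityʳ bipartite) ⟨
        2 * bipartite ∎

  countSep-family : ∀ {f : Permutation′ m → Permutation′ m → ℕ} a b c d →
    (∀ σ τ → [ separates (order₁ σ τ) a b c d ] + [ separates (order₂ σ τ) a b c d ] ≡ f σ τ) →
    countSep family a b c d ≡ total (λ σ → total (f σ) P) P
  countSep-family a b c d eq = trans (countSep-total family a b c d)
    (trans (total-family (λ σ → [ separates σ a b c d ])) (total-cong (λ σ → total-cong (eq σ) P) P))

  private
    module Pos₁ (σ τ : Permutation′ m) where
      z = pos-z (relabel σ τ layout) ≤-refl
      x = pos-x (relabel σ τ layout) ≤-refl
      y = pos-y (relabel σ τ layout) ≤-refl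

    module Pos₂ (σ τ : Permutation′ m) where
      z = pos-z (relabel σ τ (swapParts layout)) ≤-refl
      x = pos-x (relabel σ τ (swapParts layout)) ≤-refl
      y = pos-y (relabel σ τ (swapParts layout)) ≤-refl

  count-zx : ∀ {i k} j → i ≢ k → countSep family zero (xv i) (yv j) (xv k) ≡ multiplicity
  count-zx {i} {k} j i≢k = trans
    (countSep-family zero (xv i) (yv j) (xv k) λ σ τ → cong₂ _+_
      (sep-cong (Pos₁.z σ τ) (Pos₁.x σ τ i) (Pos₁.y σ τ j) (Pos₁.x σ τ k))
      (sep-cong (Pos₂.z σ τ) (Pos₂.x σ τ i) (Pos₂.y σ τ j) (Pos₂.x σ τ k)))
    (total-S j i≢k)

  count-zy : ∀ {i k} j → i ≢ k → countSep family zero (yv i) (xv j) (yv k) ≡ multiplicity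
  count-zy {i} {k} j i≢k = trans
    (countSep-family {λ σ τ → S (τ ⟨$⟩ʳ i) (τ ⟨$⟩ʳ k) (σ ⟨$⟩ʳ j)} zero (yv i) (xv j) (yv k) λ σ τ → trans (cong₂ _+_
      (sep-cong (Pos₁.z σ τ) (Pos₁.y σ τ i) (Pos₁.x σ τ j) (Pos₁.y σ τ k))
      (sep-cong (Pos₂.z σ τ) (Pos₂.y σ τ i) (Pos₂.x σ τ j) (Pos₂.y σ τ k)))
      (+-comm [ sep kz (ky (τ ⟨$⟩ʳ i)) (kx (σ ⟨$⟩ʳ j)) (ky (τ ⟨$⟩ʳ k)) ] _))
    -- Now `τ` carries the two points and `σ` the single one, so the two summations are exchanged to
    -- reach the form of `total-S`.
    (trans (total-comm (λ σ τ → S (τ ⟨$⟩ʳ i) (τ ⟨$⟩ʳ k) (σ ⟨$⟩ʳ j)) P P) (total-S j i≢k))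

  count-xy : ∀ {i j k l} → i ≢ j → k ≢ l →
    countSep family (xv i) (yv k) (xv j) (yv l) ≡ permCount n * (permCount n * (2 * bipartite))
  count-xy {i} {j} {k} {l} i≢j k≢l = trans
    (countSep-family (xv i) (yv k) (xv j) (yv l) λ σ τ → cong₂ _+_
      (sep-cong (Pos₁.x σ τ i) (Pos₁.y σ τ k) (Pos₁.x σ τ j) (Pos₁.y σ τ l))
      (sep-cong (Pos₂.x σ τ i) (Pos₂.y σ τ k) (Pos₂.x σ τ j) (Pos₂.y σ τ l)))
    (total-R i≢j k≢l)

  -- Divided by `permCount n * permCount n`, `multiplicity` becomes `suc n * hub` and the frequency
  -- of x y | x′ y′ becomes `2 * bipartite`; the hypothesis compares these two numbers.
  module _ (hub≤bipartite : suc n * hub ≤ 2 * bipartite) where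

    private
      V = Fin (1 + m + m)

      Often : V → V → V → V → Set
      Often a b c d = multiplicity ≤ countSep family a b c d

      often-cong : ∀ a b c d {a′ b′ c′ d′} →
        (∀ σ → separates σ a b c d ≡ separates σ a′ b′ c′ d′) → Often a b c d → Often a′ b′ c′ d′
      often-cong a b c d {a′} {b′} {c′} {d′} eq = subst (multiplicity ≤_)
        (trans (countSep-total family a b c d)
        (trans (total-cong (λ σ → cong [_] (eq σ)) family) (sym (countSep-total family a′ b′ c′ d′))))

      often-flipˡ : ∀ {a b c d} → Often a b c d → Often b a c d
      often-flipˡ {a} {b} {c} {d} = often-cong a b c d λ σ → sep-flipˡ (pos σ a) (pos σ b) (pos σ c) (pos σ d)

      often-flipʳ : ∀ {a b c d} → Often a b c d → Often a b d c
      often-flipʳ {a} {b} {c} {d} = often-cong a b c d λ σ → sep-flipʳ (pos σ a) (pos σ b) (pos σ c) (pos σ d)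

      often-swap : ∀ {a b c d} → Often a b c d → Often c d a b
      often-swap {a} {b} {c} {d} = often-cong a b c d λ σ → sep-swap (pos σ a) (pos σ b) (pos σ c) (pos σ d)

      often-zx-xy : ∀ {i k} j → i ≢ k → Often zero (xv i) (xv k) (yv j)
      often-zx-xy j i≢k = often-flipʳ (≤-reflexive (sym (count-zx j i≢k)))

      often-zy-xy : ∀ {i k} j → i ≢ k → Often zero (yv i) (xv j) (yv k)
      often-zy-xy j i≢k = ≤-reflexive (sym (count-zy j i≢k))

      often-xy-xy : ∀ {i j k l} → i ≢ j → k ≢ l → Often (xv i) (yv k) (xv j) (yv l)
      often-xy-xy {i} {j} {k} {l} i≢j k≢l = begin
        permCount n * permCount (suc n) * hub           ≡⟨ cong (λ v → permCount n * v * hub) (permCount-suc n) ⟩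
        permCount n * (suc n * permCount n) * hub       ≡⟨ lem (permCount n) (suc n) hub ⟩
        permCount n * (permCount n * (suc n * hub))     ≤⟨ *-monoʳ-≤ (permCount n) (*-monoʳ-≤ (permCount n) hub≤bipartite) ⟩
        permCount n * (permCount n * (2 * bipartite))   ≡⟨ count-xy i≢j k≢l ⟨
        countSep family (xv i) (yv k) (xv j) (yv l)     ∎
        where
        open ≤-Reasoning
        lem : ∀ a b c → a * (b * a) * c ≡ a * (a * (b * c))
        lem = solve-∀

      Disjoint : V → V → V → V → Set
      Disjoint a b c d = (a ≢ c) × (a ≢ d) × (b ≢ c) × (b ≢ d)

      separated : ∀ a b → Adj m a b → ∀ c d → Adj m c d → Disjoint a b c d → Often a b c d
      separated = edge-elim (λ a b → ∀ c d → Adj m c d → Disjoint a b c d → Often a b c d)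
        (λ q c d adj (ac , ad , bc , bd) → often-flipˡ (q c d adj (bc , bd , ac , ad)))
        (λ i → edge-elim _ (flipDisjoint zero (xv i))
          (λ _ (zz , _) → contradiction refl zz)
          (λ _ (zz , _) → contradiction refl zz)
          (λ k j (_ , _ , ik , _) → often-zx-xy j (ik ∘ cong xv)))
        (λ i → edge-elim _ (flipDisjoint zero (yv i))
          (λ _ (zz , _) → contradiction refl zz)
          (λ _ (zz , _) → contradiction refl zz)
          (λ j k (_ , _ , _ , ik) → often-zy-xy j (ik ∘ cong yv)))
        (λ i k → edge-elim _ (flipDisjoint (xv i) (yv k))
          (λ j (_ , ij , _) → often-swap (often-zx-xy k (ij ∘ cong xv ∘ sym)))
          (λ l (_ , _ , _ , kl) → often-swap (often-zy-xy i (kl ∘ cong yv ∘ sym)))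
          (λ j l (ij , _ , _ , kl) → often-xy-xy (ij ∘ cong xv) (kl ∘ cong yv)))
        where
        flipDisjoint : ∀ a b {c d} → (Disjoint a b c d → Often a b c d) → Disjoint a b d c → Often a b d c
        flipDisjoint a b q (ac , ad , bc , bd) = often-flipʳ (q (ad , ac , bd , bc))

    family-separating : TSeparating m multiplicity family
    family-separating a b c d (ab , cd , disjoint) = separated a b ab c d cd disjoint

-- Existence of π_t and arithmetic of the target value

least : {P : ℕ → Set} → (∀ k → Dec (P k)) → ∀ {n} → P n → ∃[ k ] (P k × (∀ j → P j → k ≤ j))
least {P} P? {n} Pn with search (suc n)
  where
  search : ∀ n → (∃[ k ] (P k × (∀ j → P j → k ≤ j))) ⊎ (∀ j → j < n → ¬ P j)
  search zero    = inj₂ λ _ ()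
  search (suc n) with search n | P? n
  ... | inj₁ found | _      = inj₁ found
  ... | inj₂ none  | yes Pn = inj₁ (n , Pn , λ j Pj → ≮⇒≥ λ j<n → none j j<n Pj)
  ... | inj₂ none  | no ¬Pn = inj₂ λ j j<1+n Pj → ¬Pn (subst P (≤-antisym (≤-pred j<1+n) (≮⇒≥ λ j<n → none j j<n Pj)) Pj)
... | inj₁ found = found
... | inj₂ none  = contradiction Pn (none n ≤-refl)

_≈_ : ∀ {n} → LinOrd n → LinOrd n → Set
σ ≈ τ = ∀ i → σ ⟨$⟩ʳ i ≡ τ ⟨$⟩ʳ i

≈-refl : ∀ {n} (L : List (LinOrd n)) → Pointwise _≈_ L L
≈-refl []      = []
≈-refl (σ ∷ L) = (λ _ → refl) ∷ ≈-refl L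

-- Lists of orderings of a given length form a finite set only up to pointwise equality, so `Q` has
-- to respect `_≈_` before `permutations n` can stand for all orderings. The decision feeds `least`,
-- which produces π_t.
∃-listOfLength? : ∀ {n} {Q : List (LinOrd n) → Set} → (∀ {L M} → Pointwise _≈_ L M → Q L → Q M) →
                  (∀ L → Dec (Q L)) → ∀ k → Dec (∃[ L ] (length L ≡ k × Q L))
∃-listOfLength? resp Q? zero = map′ (λ q → [] , refl , q) (λ { ([] , _ , q) → q }) (Q? [])
∃-listOfLength? {n} {Q} resp Q? (suc k) = map′ to from
  (anyList? (λ π → ∃-listOfLength? {Q = Q ∘ (π ∷_)} (λ L≈M → resp ((λ _ → refl) ∷ L≈M)) (Q? ∘ (π ∷_)) k) (permutations n))
  where
  Extends : LinOrd n → Set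
  Extends π = ∃[ L ] (length L ≡ k × Q (π ∷ L))
  to : Any Extends (permutations n) → ∃[ L ] (length L ≡ suc k × Q L)
  to found with satisfied found
  ... | π , L , len , q = π ∷ L , cong suc len , q
  from : (∃[ L ] (length L ≡ suc k × Q L)) → Any Extends (permutations n)
  from (σ ∷ L , len , q) = Any.map (λ π≈σ → L , suc-injective len , resp ((λ i → sym (π≈σ i)) ∷ ≈-refl L) q)
                                  (permutations-complete σ)

countSep-resp : ∀ {n} {L M : List (LinOrd n)} → Pointwise _≈_ L M → ∀ a b c d → countSep L a b c d ≡ countSep M a b c d
countSep-resp []            a b c d = refl
countSep-resp (σ≈τ ∷ L≈M) a b c d = cong₂ _+_
  (sep-cong (cong toℕ (σ≈τ a)) (cong toℕ (σ≈τ b)) (cong toℕ (σ≈τ c)) (cong toℕ (σ≈τ d)))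
  (countSep-resp L≈M a b c d)

tSeparating? : ∀ m t L → Dec (TSeparating m t L)
tSeparating? m t L = all? λ a → all? λ b → all? λ c → all? λ d →
  (¬? (part m a ≟ part m b) ×-dec ¬? (part m c ≟ part m d) ×-dec
   ¬? (a ≟ᶠ c) ×-dec ¬? (a ≟ᶠ d) ×-dec ¬? (b ≟ᶠ c) ×-dec ¬? (b ≟ᶠ d))
  →-dec (t ≤? countSep L a b c d)

πₜ-exists : ∀ {m t} (L : List (LinOrd (1 + m + m))) → TSeparating m t L → ∃[ k ] IsPiT m t k
πₜ-exists {m} {t} L sepL with least (∃-listOfLength? (λ L≈M q a b c d ni → subst (t ≤_) (countSep-resp L≈M a b c d) (q a b c d ni)) (tSeparating? m t)) (L , refl , sepL)
... | k , witness , minimal = k , witness , λ M sepM → minimal (length M) (M , refl , sepM)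

-- Repeated lists

copies : ∀ {A : Set} → ℕ → List A → List A
copies j L = concat (replicate j L)

length-copies : ∀ {A : Set} j (L : List A) → length (copies j L) ≡ j * length L
length-copies zero    L = refl
length-copies (suc j) L = trans (length-++ L) (cong (length L +_) (length-copies j L))

countSep-copies : ∀ {n} j (L : List (LinOrd n)) a b c d → countSep (copies j L) a b c d ≡ j * countSep L a b c d
countSep-copies zero    L a b c d = refl
countSep-copies (suc j) L a b c d = begin
  countSep (L ++ copies j L) a b c d         ≡⟨ countSep-total (L ++ copies j L) a b c d ⟩
  total f (L ++ copies j L)                  ≡⟨ total-++ f L (copies j L) ⟩
  total f L + total f (copies j L)           ≡⟨ cong₂ _+_ (countSep-total L a b c d) (countSep-total (copies j L) a b c d) ⟨
  countSep L a b c d + countSep (copies j L) a b c d ≡⟨ cong (countSep L a b c d +_) (countSep-copies j L a b c d) ⟩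
  suc j * countSep L a b c d                 ∎
  where
  open ≡-Reasoning
  f = λ σ → [ separates σ a b c d ]

copies-separating : ∀ {m t} j L → TSeparating m t L → TSeparating m (j * t) (copies j L)
copies-separating j L sepL a b c d ni =
  ≤-trans (*-monoʳ-≤ j (sepL a b c d ni)) (≤-reflexive (sym (countSep-copies j L a b c d)))

separating-weaken : ∀ {m s t} L → s ≤ t → TSeparating m t L → TSeparating m s L
separating-weaken L s≤t sepL a b c d ni = ≤-trans s≤t (sepL a b c d ni)

-- Rational inequalities

-- `_/_` reduces fractions, so the comparison is made on unnormalised rationals, where the order is
-- cross multiplication.
/-mono-≤ : ∀ {a b c d} → a * suc d ≤ c * suc b → ((ℤ.+ a) / suc b) ≤ℚ ((ℤ.+ c) / suc d)
/-mono-≤ {a} {b} {c} {d} le = ℚ.toℚᵘ-cancel-≤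
  (ℚᵘ.≤-respˡ-≃ (ℚᵘ.≃-sym (ℚ.toℚᵘ-fromℚᵘ (mkℚᵘ (ℤ.+ a) b)))
  (ℚᵘ.≤-respʳ-≃ (ℚᵘ.≃-sym (ℚ.toℚᵘ-fromℚᵘ (mkℚᵘ (ℤ.+ c) d)))
  (*≤* (subst₂ ℤ._≤_ (ℤ.pos-* a (suc d)) (ℤ.pos-* c (suc b)) (ℤ.+≤+ le)))))

q-ε≤q : ∀ q ε → Positive ε → (q - ε) ≤ℚ q
q-ε≤q q ε ε>0 = subst ((q - ε) ≤ℚ_) (ℚ.+-identityʳ q)
  (ℚ.+-monoʳ-≤ q (ℚ.neg-antimono-≤ (ℚ.<⇒≤ (ℚ.positive⁻¹ ε {{ε>0}}))))

q≤q+ε : ∀ q ε → Positive ε → q ≤ℚ (q +ℚ ε)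
q≤q+ε q ε ε>0 = subst (_≤ℚ (q +ℚ ε)) (ℚ.+-identityʳ q) (ℚ.+-monoʳ-≤ q (ℚ.<⇒≤ (ℚ.positive⁻¹ ε {{ε>0}})))

-- Closed forms by parity

squares-closed : ∀ n → 3 * squares (suc n) ≡ n * suc n * (2 * n + 1)
squares-closed zero    = refl
squares-closed (suc n) = trans (*-distribˡ-+ 3 (2 * (suc n * suc n)) (squares (suc n)))
  (trans (cong (3 * (2 * (suc n * suc n)) +_) (squares-closed n)) (lem n))
  where
  lem : ∀ n → 3 * (2 * (suc n * suc n)) + n * suc n * (2 * n + 1) ≡ suc n * suc (suc n) * (2 * suc n + 1)
  lem = solve-∀

partial-squares-closed : ∀ n → 6 * partial squares (2 + n) ≡ (2 + n) * suc n * (suc n * n)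
partial-squares-closed zero    = refl
partial-squares-closed (suc n) = begin
  6 * (squares (2 + n) + partial squares (2 + n))
    ≡⟨ lem₁ (squares (2 + n)) (partial squares (2 + n)) ⟩
  2 * (3 * squares (2 + n)) + 6 * partial squares (2 + n)
    ≡⟨ cong₂ (λ s t → 2 * s + t) (squares-closed (suc n)) (partial-squares-closed n) ⟩
  2 * (suc n * suc (suc n) * (2 * suc n + 1)) + (2 + n) * suc n * (suc n * n)
    ≡⟨ lem₂ n ⟩
  (3 + n) * suc (suc n) * (suc (suc n) * suc n) ∎
  where
  open ≡-Reasoning
  lem₁ : ∀ a b → 6 * (a + b) ≡ 2 * (3 * a) + 6 * b
  lem₁ = solve-∀
  lem₂ : ∀ n → 2 * (suc n * suc (suc n) * (2 * suc n + 1)) + (2 + n) * suc n * (suc n * n) ≡ (3 + n) * suc (suc n) * (suc (suc n) * suc n)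
  lem₂ = solve-∀

data Parity : ℕ → Set where
  even : ∀ k → Parity (k + k)
  odd  : ∀ k → Parity (suc (k + k))

evenOrOdd : ∀ n → Parity n
evenOrOdd zero = even 0
evenOrOdd (suc n) with evenOrOdd n
... | even k = odd k
... | odd k  = subst Parity (cong suc (+-suc k k)) (even (suc k))

-- The two closed forms of 3 hub below are m (8m² − 3m − 2) / 4 for m = 2k + 2
-- and (m − 1) (8m² + 5m + 3) / 4 for m = 2k + 3.
module HubArithmetic (n H : ℕ) (H-value : 2 * H + squares (2 + n) ≡ 2 * ((2 + n) * c₂ (2 + n)) + 2 * balance (2 + n)) where

  private
    6H : 2 * (3 * H) + suc n * (2 + n) * (2 * suc n + 1) ≡ 3 * (2 * ((2 + n) * c₂ (2 + n)) + 2 * balance (2 + n))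
    6H = trans (cong (λ s → 2 * (3 * H) + s) (sym (squares-closed (suc n))))
        (trans (lem H (squares (2 + n))) (cong (3 *_) H-value))
      where
      lem : ∀ H s → 2 * (3 * H) + 3 * s ≡ 3 * (2 * H + s)
      lem = solve-∀

  3H-even : ∀ k → n ≡ k + k → 3 * H ≡ suc k * (16 * (k * k) + 29 * k + 12)
  3H-even k refl = *-cancelˡ-≡ _ _ 2 (+-cancelʳ-≡ (suc (k + k) * (2 + (k + k)) * (2 * suc (k + k) + 1)) _ _
    (trans 6H (trans (cong (λ b → 3 * (2 * ((2 + (k + k)) * c₂ (2 + (k + k))) + 2 * b)) bal) (lem k))))
    where
    bal : balance (2 + (k + k)) ≡ suc k * suc k
    bal = cong₂ (λ a b → suc a * suc b) (sym (n≡⌊n+n/2⌋ k)) (sym (n≡⌈n+n/2⌉ k))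
    lem : ∀ k → 3 * (2 * ((2 + (k + k)) * ((2 + (k + k)) * suc (k + k))) + 2 * (suc k * suc k))
              ≡ 2 * (suc k * (16 * (k * k) + 29 * k + 12)) + suc (k + k) * (2 + (k + k)) * (2 * suc (k + k) + 1)
    lem = solve-∀

  3H-odd : ∀ k → n ≡ suc (k + k) → 3 * H ≡ suc k * (16 * (k * k) + 53 * k + 45)
  3H-odd k refl = *-cancelˡ-≡ _ _ 2 (+-cancelʳ-≡ (suc (suc (k + k)) * (2 + suc (k + k)) * (2 * suc (suc (k + k)) + 1)) _ _
    (trans 6H (trans (cong (λ b → 3 * (2 * ((2 + suc (k + k)) * c₂ (2 + suc (k + k))) + 2 * b)) bal) (lem k))))
    where
    bal : balance (2 + suc (k + k)) ≡ suc k * suc (suc k)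
    bal = cong₂ (λ a b → suc a * suc (suc b)) (sym (n≡⌈n+n/2⌉ k)) (sym (n≡⌊n+n/2⌋ k))
    lem : ∀ k → 3 * (2 * ((2 + suc (k + k)) * ((2 + suc (k + k)) * suc (suc (k + k)))) + 2 * (suc k * suc (suc k)))
              ≡ 2 * (suc k * (16 * (k * k) + 53 * k + 45)) + suc (suc (k + k)) * (2 + suc (k + k)) * (2 * suc (suc (k + k)) + 1)
    lem = solve-∀

  -- After multiplication by 3 and addition of `W` both sides are polynomials in `k`. The slack is
  -- `3 * (k * (suc (k + k) * suc k))` for even `n` and `6 * (suc k * (suc k * suc k))` for odd `n`;
  -- it vanishes only for `n = 0`.
  H≤bipartite : ∀ B → 2 * B + 2 * partial squares (2 + n) ≡ c₂ (2 + n) * c₂ (2 + n) → suc n * H ≤ 2 * B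
  H≤bipartite B B-value = *-cancelˡ-≤ 3 (+-cancelʳ-≤ W _ _ (≤-trans (le (evenOrOdd n) refl) (≤-reflexive (sym 6B))))
    where
    W = (2 + n) * suc n * (suc n * n)
    6B : 3 * (2 * B) + W ≡ 3 * (c₂ (2 + n) * c₂ (2 + n))
    6B = trans (cong (3 * (2 * B) +_) (sym (partial-squares-closed n)))
        (trans (lem B (partial squares (2 + n))) (cong (3 *_) B-value))
      where
      lem : ∀ B w → 3 * (2 * B) + 6 * w ≡ 3 * (2 * B + 2 * w)
      lem = solve-∀
    comm : ∀ a h → 3 * (a * h) ≡ a * (3 * h)
    comm = solve-∀
    le : ∀ {p} → Parity p → n ≡ p → 3 * (suc n * H) + W ≤ 3 * (c₂ (2 + n) * c₂ (2 + n))
    le (even k) refl = m+n≤o⇒m≤o _ (≤-reflexive (trans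
      (cong (λ h → h + W + 3 * (k * (suc (k + k) * suc k))) (trans (comm (suc n) H) (cong (suc n *_) (3H-even k refl)))) (lem k)))
      where
      lem : ∀ k → suc (k + k) * (suc k * (16 * (k * k) + 29 * k + 12)) + (2 + (k + k)) * suc (k + k) * (suc (k + k) * (k + k)) + 3 * (k * (suc (k + k) * suc k))
                ≡ 3 * ((2 + (k + k)) * suc (k + k) * ((2 + (k + k)) * suc (k + k)))
      lem = solve-∀
    le (odd k) refl = m+n≤o⇒m≤o _ (≤-reflexive (trans
      (cong (λ h → h + W + 6 * (suc k * (suc k * suc k))) (trans (comm (suc n) H) (cong (suc n *_) (3H-odd k refl)))) (lem k)))
      where
      lem : ∀ k → suc (suc (k + k)) * (suc k * (16 * (k * k) + 53 * k + 45)) + (2 + suc (k + k)) * suc (suc (k + k)) * (suc (suc (k + k)) * suc (k + k)) + 6 * (suc k * (suc k * suc k))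
                ≡ 3 * ((2 + suc (k + k)) * suc (suc (k + k)) * ((2 + suc (k + k)) * suc (suc (k + k))))
      lem = solve-∀

  -- `2 * ⌈ m /2⌉ ∸ 1` is the odd one of `m ∸ 1` and `m`, so each parity reduces the claim to a
  -- polynomial identity. The factor 3 clears the denominator in the sum of squares.
  target-ratio : 24 * (2 + n) * (2 * ⌈ 2 + n /2⌉ ∸ 1) * H
               ≡ 2 * ((2 + n) * c₂ (2 + n)) * suc ((8 * (2 + n) + 5) * (2 * ⌈ 2 + n /2⌉ ∸ 1) + 2)
  target-ratio = *-cancelˡ-≡ _ _ 3 (trans (comm (24 * (2 + n) * (2 * ⌈ 2 + n /2⌉ ∸ 1)) H) (go (evenOrOdd n) refl))
    where
    comm : ∀ a h → 3 * (a * h) ≡ a * (3 * h)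
    comm = solve-∀
    go : ∀ {p} → Parity p → n ≡ p → 24 * (2 + n) * (2 * ⌈ 2 + n /2⌉ ∸ 1) * (3 * H)
       ≡ 3 * (2 * ((2 + n) * c₂ (2 + n)) * suc ((8 * (2 + n) + 5) * (2 * ⌈ 2 + n /2⌉ ∸ 1) + 2))
    go (even k) refl = trans (cong₂ (λ c h → 24 * (2 + (k + k)) * (2 * suc c ∸ 1) * h) (sym (n≡⌈n+n/2⌉ k)) (3H-even k refl))
      (trans (lem k) (cong (λ c → 3 * (2 * ((2 + (k + k)) * c₂ (2 + (k + k))) * suc ((8 * (2 + (k + k)) + 5) * (2 * suc c ∸ 1) + 2))) (n≡⌈n+n/2⌉ k)))
      where
      -- `k + (suc k + 0)` is what `2 * suc k ∸ 1` evaluates to; this keeps truncated subtraction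
      -- out of the identity.
      lem : ∀ k → 24 * (2 + (k + k)) * (k + (suc k + 0)) * (suc k * (16 * (k * k) + 29 * k + 12))
                ≡ 3 * (2 * ((2 + (k + k)) * ((2 + (k + k)) * suc (k + k))) * suc ((8 * (2 + (k + k)) + 5) * (k + (suc k + 0)) + 2))
      lem = solve-∀
    go (odd k) refl = trans (cong₂ (λ c h → 24 * (3 + (k + k)) * (2 * suc (suc c) ∸ 1) * h) (sym (n≡⌊n+n/2⌋ k)) (3H-odd k refl))
      (trans (lem k) (cong (λ c → 3 * (2 * ((3 + (k + k)) * c₂ (3 + (k + k))) * suc ((8 * (3 + (k + k)) + 5) * (2 * suc (suc c) ∸ 1) + 2))) (n≡⌊n+n/2⌋ k)))
      where
      lem : ∀ k → 24 * (3 + (k + k)) * (suc k + (suc (suc k) + 0)) * (suc k * (16 * (k * k) + 53 * k + 45))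
                ≡ 3 * (2 * ((3 + (k + k)) * ((3 + (k + k)) * suc (suc (k + k)))) * suc ((8 * (3 + (k + k)) + 5) * (suc k + (suc (suc k) + 0)) + 2))
      lem = solve-∀

-- The value of the fractional separation dimension

permCount-positive : ∀ n → 0 < permCount n
permCount-positive n = nonempty (permutations-complete {n} idₚ)
  where
  nonempty : ∀ {A : Set} {P : A → Set} {L} → Any P L → 0 < length L
  nonempty (here _)  = s≤s z≤n
  nonempty (there _) = s≤s z≤n

*-positive : ∀ {a b} → 0 < a → 0 < b → 0 < a * b
*-positive (s≤s _) (s≤s _) = s≤s z≤n

module Main (n : ℕ) where
  open Family n
  open Balanced m using (hub; hub-value; bipartite; bipartite-value)
  open HubArithmetic n hub hub-value

  pairs num den : ℕ
  pairs = 2 * (m * c₂ m)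
  num = 24 * m * (2 * ⌈ m /2⌉ ∸ 1)
  den = suc ((8 * m + 5) * (2 * ⌈ m /2⌉ ∸ 1) + 2)

  hub-positive : 0 < hub
  hub-positive = positive num hub target-ratio
    where
    positive : ∀ a h {b} → a * h ≡ suc b → 0 < h
    positive a zero    e = contradiction (trans (sym (*-zeroʳ a)) e) λ ()
    positive a (suc h) e = s≤s z≤n

  instance
    hub-nonZero : NonZero hub
    hub-nonZero = >-nonZero hub-positive

  multiplicity-positive : 0 < multiplicity
  multiplicity-positive = *-positive (*-positive (permCount-positive n) (permCount-positive (suc n))) hub-positive

  separating : TSeparating m multiplicity family
  separating = family-separating (H≤bipartite bipartite bipartite-value)

  -- Every ordering of the family attains `hub`, and all pairs at `z` are separated equally often,
  -- so the double count of `separating-length` is an equality here.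
  family-ratio : length family * hub ≡ multiplicity * pairs
  family-ratio = begin
    length family * hub
      ≡⟨ cong (_* hub) length-family ⟩
    2 * (permCount m * permCount m) * hub
      ≡⟨ cong (λ p → 2 * (p * p) * hub) (permCount-suc (suc n)) ⟩
    2 * (m * permCount (suc n) * (m * permCount (suc n))) * hub
      ≡⟨ cong (λ p → 2 * (m * permCount (suc n) * (m * p)) * hub) (permCount-suc n) ⟩
    2 * (m * permCount (suc n) * (m * (suc n * permCount n))) * hub
      ≡⟨ lem m (suc n) (permCount (suc n)) (permCount n) hub ⟩
    multiplicity * pairs ∎
    where
    open ≡-Reasoning
    lem : ∀ m n p q h → 2 * (m * p * (m * (n * q))) * h ≡ q * p * h * (2 * (m * (m * n)))
    lem = solve-∀

  exists : ∀ s → ∃[ k ] IsPiT m (suc s) k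
  exists s = πₜ-exists (copies (suc s) family)
    (separating-weaken (copies (suc s) family) (m≤m*n (suc s) multiplicity {{>-nonZero multiplicity-positive}})
      (copies-separating (suc s) family separating))

  lower : ∀ s k → IsPiT m (suc s) k → targetValue m ≤ℚ ((ℤ.+ k) / suc s)
  lower s k ((L , refl , sepL) , _) = /-mono-≤ {num} {_} {length L} {s} (*-cancelʳ-≤ (num * suc s) (length L * den) hub (begin
    num * suc s * hub       ≡⟨ lem num (suc s) hub ⟩
    num * hub * suc s       ≡⟨ cong (_* suc s) target-ratio ⟩
    pairs * den * suc s     ≡⟨ lem pairs den (suc s) ⟩
    pairs * suc s * den     ≤⟨ *-monoˡ-≤ den (separating-length L sepL) ⟩
    length L * hub * den    ≡⟨ lem (length L) hub den ⟩
    length L * den * hub    ∎))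
    where
    open ≤-Reasoning
    lem : ∀ a b c → a * b * c ≡ a * c * b
    lem = solve-∀

  upper : ∀ j s k → suc s ≡ j * multiplicity → IsPiT m (suc s) k → ((ℤ.+ k) / suc s) ≤ℚ targetValue m
  upper j s k e (_ , minimal) = /-mono-≤ {k} {s} {num} (*-cancelʳ-≤ (k * den) (num * suc s) hub (begin
    k * den * hub                           ≤⟨ *-monoˡ-≤ hub (*-monoˡ-≤ den k≤) ⟩
    j * length family * den * hub           ≡⟨ lem₁ j (length family) den hub ⟩
    j * (length family * hub) * den         ≡⟨ cong (λ v → j * v * den) family-ratio ⟩
    j * (multiplicity * pairs) * den        ≡⟨ lem₂ j multiplicity pairs den ⟩
    pairs * den * (j * multiplicity)        ≡⟨ cong₂ _*_ target-ratio e ⟨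
    num * hub * suc s                       ≡⟨ lem₃ num hub (suc s) ⟩
    num * suc s * hub                       ∎))
    where
    open ≤-Reasoning
    k≤ : k ≤ j * length family
    k≤ = ≤-trans (minimal (copies j family) (separating-weaken (copies j family) (≤-reflexive e) (copies-separating j family separating)))
                 (≤-reflexive (length-copies j family))
    lem₁ : ∀ a b c d → a * b * c * d ≡ a * (b * d) * c
    lem₁ = solve-∀
    lem₂ : ∀ a b c d → a * (b * c) * d ≡ c * d * (a * b)
    lem₂ = solve-∀
    lem₃ : ∀ a b c → a * b * c ≡ a * c * b
    lem₃ = solve-∀

  arbitrarilyLarge : ∀ N c → 0 < c → ∃[ s ] (N ≤ s × suc s ≡ suc N * c)
  arbitrarilyLarge N (suc c) _ = c + N * suc c , ≤-trans (m≤m*n N (suc c)) (m≤n+m (N * suc c) c) , refl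

  theorem : FracSepDimIs m (targetValue m)
  theorem = exists
    -- The lower bound holds without error at every `t`, hence the threshold 0.
    , (λ ε ε>0 → 0 , λ s _ k isPi → ℚ.≤-trans (q-ε≤q (targetValue m) ε ε>0) (lower s k isPi))
    , λ ε ε>0 N →
        -- Choosing `suc s` as a multiple of `multiplicity` lets whole copies of the family attain
        -- the value exactly.
        let s , N≤s , e = arbitrarilyLarge N multiplicity multiplicity-positive
            k , isPi = exists s
        in s , N≤s , k , isPi , ℚ.≤-trans (upper (suc N) s k e isPi) (q≤q+ε (targetValue m) ε ε>0)

mainTheorem13 : (m : ℕ) → 2 ≤ m → FracSepDimIs m (targetValue m)
mainTheorem13 (suc (suc n)) _ = Main.theorem n
mainTheorem13 (suc zero) (s≤s ())
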